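{- For $n\ge 0$ let $B_n(Y_0,Y_1,Z)$ be the polynomials defined by the identity of formal power series in $u$ $$\sum_{n\ge 0}\frac{u^n}{n!}B_n(Y_0,Y_1,Z)=\bigl(1-u(1+Z)\bigr)^{ -1}\times\frac{\exp\bigl(u(Y_0+Y_1Z)\bigr)}{\exp\bigl(u(1+Z)\bigr)}.$$ Then for every $n\ge 0$, $$B_n(Y_0,Y_1,Z)=\sum_{w\in B_n}Y_1^{\mathrm{fix}^-w}\,Y_0^{\mathrm{fix}^+w}\,Z^{\mathrm{neg}\,w}=\sum_{w\in B_n}Y_1^{\mathrm{pix}^-w}\,Y_0^{\mathrm{pix}^+w}\,Z^{\mathrm{neg}\,w}.$$
   Context: $B_n$ (the hyperoctahedral group) is the set of signed permutations of order $n$: words $w=x_1x_2\cdots x_n$ with each $x_i\in\{ -n,\dots,-1,1,\dots,n\}$ such that $|x_1||x_2|\cdots|x_n|$ is a permutation of $12\cdots n$. $\mathrm{neg}\,w$ is the number of negative letters of $w$. A positive fixed point of $w$ is a positive integer $i$ with $x_i=i$; a negative fixed point is $-i$ with $i>0$ and $x_i=-i$; $\mathrm{fix}^+w$ and $\mathrm{fix}^-w$ are the numbers of positive and negative fixed points. A word $x_1\cdots x_m$ of distinct integers is a desarrangement if there is $k\ge1$ with $x_1>x_2>\cdots>x_{2k}$ and $x_{2k}<x_{2k+1}$, with the convention $x_{m+1}=\infty$ (so no one-letter word is a desarrangement); the empty word is also a desarrangement. Every $w\in B_n$ has a unique factorization $w=w^-w^+w^d$ (pixed factorization), where $w^d$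 is the longest right factor of $w$ that is a desarrangement, $w^-$ is an increasing word all of whose letters are negative and $w^+$ is an increasing word all of whose letters are positive. $\mathrm{pix}^-w$ and $\mathrm{pix}^+w$ are the lengths of $w^-$ and $w^+$. -}

module Defs where

open import Data.Nat as ℕ using (ℕ; zero; suc; _∸_)
open import Data.Nat.Properties using (_!≢0)
open import Data.Nat.Base using (_!)
open import Data.Integer as ℤ using (ℤ; +_; -[1+_]; ∣_∣)
open import Data.Rational as ℚ using (ℚ; 0ℚ; 1ℚ; _/_)
open import Data.Bool using (Bool; true; false; if_then_else_; _∧_)
open import Data.List as List using (List; []; _∷_; map; length; filter; concatMap; take; takeWhile; upTo; zipWith)
open import Relation.Nullary.Decidable using (does)
open import Relation.Binary.PropositionalEquality using (_≡_)
import Data.List.Relation.Unary.Unique.DecPropositional as UDP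
open import Data.Product using (_×_; _,_; proj₁; proj₂)

-- Formal power series in four commuting variables u, Y0, Y1, Z over ℚ,
-- given by their coefficient functions:  f n a b c  is the coefficient
-- of  u^n Y0^a Y1^b Z^c.

Ser : Set
Ser = ℕ → ℕ → ℕ → ℕ → ℚ

sumTo : ℕ → (ℕ → ℚ) → ℚ
sumTo zero    f = f zero
sumTo (suc n) f = sumTo n f ℚ.+ f (suc n)

_⊕_ : Ser → Ser → Ser
(f ⊕ g) n a b c = f n a b c ℚ.+ g n a b c

_⊖_ : Ser → Ser → Ser
(f ⊖ g) n a b c = f n a b c ℚ.- g n a b c

_⊗_ : Ser → Ser → Ser
(f ⊗ g) n a b c =
  sumTo n λ i → sumTo a λ j → sumTo b λ k → sumTo c λ l →
    f i j k l ℚ.* g (n ∸ i) (a ∸ j) (b ∸ k) (c ∸ l)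

infixl 6 _⊕_ _⊖_
infixl 7 _⊗_

mono : ℕ → ℕ → ℕ → ℕ → Ser
mono n0 a0 b0 c0 n a b c =
  if does (n ℕ.≟ n0) ∧ does (a ℕ.≟ a0) ∧ does (b ℕ.≟ b0) ∧ does (c ℕ.≟ c0)
  then 1ℚ else 0ℚ

oneS uS Y0S Y1S ZS : Ser
oneS = mono 0 0 0 0
uS   = mono 1 0 0 0
Y0S  = mono 0 1 0 0
Y1S  = mono 0 0 1 0
ZS   = mono 0 0 0 1

_^S_ : Ser → ℕ → Ser
f ^S zero  = oneS
f ^S suc k = f ⊗ (f ^S k)

1/! : ℕ → ℚ
1/! k = (+ 1 / (k !)) {{k !≢0}}

-- exp f = Σ_k f^k / k!, for f with no u^0 term (so only k ≤ n
-- contributes to the coefficient of u^n).  Only applied to series of the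
-- form u·g below.
expS : Ser → Ser
expS f n a b c = sumTo n λ k → 1/! k ℚ.* (f ^S k) n a b c

-- Σ_n u^n/n! B_n  for a sequence of polynomials B_n given by coefficient
-- functions  B n a b c = coefficient of Y0^a Y1^b Z^c in B_n.
egf : (ℕ → ℕ → ℕ → ℕ → ℚ) → Ser
egf B n a b c = B n a b c ℚ.* 1/! n

words : {A : Set} → ℕ → List A → List (List A)
words zero    L = [] ∷ []
words (suc m) L = concatMap (λ x → map (x ∷_) (words m L)) L

letters : ℕ → List ℤ
letters n = map (λ i → -[1+ i ]) (upTo n) List.++ map (λ i → + suc i) (upTo n)

-- B_n : words x1..xn over ±1..±n such that |x1|..|xn| are pairwise distinct
-- (hence a permutation of 1..n)
signedPerms : ℕ → List (List ℤ)
signedPerms n = filter (λ w → UDP.unique? ℕ._≟_ (map ∣_∣ w)) (words n (letters n))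

isNeg : ℤ → Bool
isNeg (+ _)    = false
isNeg -[1+ _ ] = true

count : {A : Set} → (A → Bool) → List A → ℕ
count p []       = 0
count p (x ∷ xs) = if p x then suc (count p xs) else count p xs

neg : List ℤ → ℕ
neg = count isNeg

positions : List ℤ → List (ℕ × ℤ)
positions w = zipWith _,_ (map suc (upTo (length w))) w

fix⁺ : List ℤ → ℕ
fix⁺ w = count (λ p → does (proj₂ p ℤ.≟ + proj₁ p)) (positions w)

fix⁻ : List ℤ → ℕ
fix⁻ w = count (λ p → does (proj₂ p ℤ.≟ ℤ.- (+ proj₁ p))) (positions w)

-- length of the maximal strictly decreasing initial run x1 > x2 > ... > xd
-- (so x_d < x_{d+1}, or d = length, i.e. x_{m+1} = ∞)
decRun : List ℤ → ℕ
decRun []           = 0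
decRun (x ∷ [])     = 1
decRun (x ∷ y ∷ ys) = if does (y ℤ.<? x) then suc (decRun (y ∷ ys)) else 1

even : ℕ → Bool
even zero          = true
even (suc zero)    = false
even (suc (suc n)) = even n

-- desarrangement: empty, or x1 > ... > x_{2k} < x_{2k+1} for some k ≥ 1
-- (x_{m+1} = ∞).  For a nonempty word the index 2k is forced to be the
-- position of the first ascent, i.e. decRun w, which is ≥ 1.
isDes : List ℤ → Bool
isDes []       = true
isDes (x ∷ xs) = even (decRun (x ∷ xs))

dropToDes : List ℤ → ℕ
dropToDes []       = 0
dropToDes (x ∷ xs) = if isDes (x ∷ xs) then 0 else suc (dropToDes xs)

-- w = w⁻ w⁺ wᵈ : the prefix w⁻ w⁺ before wᵈ
nonDesPrefix : List ℤ → List ℤ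
nonDesPrefix w = take (dropToDes w) w

-- w⁻ = the (increasing, negative) initial segment of w⁻w⁺ ; w⁺ = the rest
pix⁻ : List ℤ → ℕ
pix⁻ w = length (takeWhile (λ x → x ℤ.<? + 0) (nonDesPrefix w))

pix⁺ : List ℤ → ℕ
pix⁺ w = length (nonDesPrefix w) ∸ pix⁻ w

fixPoly : ℕ → ℕ → ℕ → ℕ → ℚ
fixPoly n a b c = (+ count (λ w → does (fix⁺ w ℕ.≟ a) ∧ does (fix⁻ w ℕ.≟ b) ∧ does (neg w ℕ.≟ c))
                           (signedPerms n)) / 1

pixPoly : ℕ → ℕ → ℕ → ℕ → ℚ
pixPoly n a b c = (+ count (λ w → does (pix⁺ w ℕ.≟ a) ∧ does (pix⁻ w ℕ.≟ b) ∧ does (neg w ℕ.≟ c))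
                           (signedPerms n)) / 1

{-# OPTIONS --safe #-}

-- Write p = Y₀ + Y₁Z and q = 1 + Z, so the identity says Σ uⁿ/n! Bₙ = exp(up) exp(−uq) / (1 − uq).
--
-- Pixed factorization: summing over all ways to cut off an increasing prefix of length j,
-- the weight of w is Σ_j [x₁<⋯<x_j] wt(x₁)⋯wt(x_j) [x_{j+1}⋯x_n is a desarrangement] Z^neg, and
-- inclusion–exclusion on the decreasing run gives [v is a desarrangement] = Σ_k (−1)^k [v₁>⋯>v_k].
-- As exactly one of the j! orders of j distinct letters is monotone, cutting off a monotone
-- prefix multiplies the exponential generating function by exp(u·(sum of the two weights of ±a)):
-- by exp(up) for the increasing prefix and by exp(−uq) for the decreasing one. What remains is
-- an arbitrary signed word, with generating function 1/(1 − uq).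
--
-- Fixed points: the weight of w is a product over the positions, so the sum is a permanent.
-- Writing the row of each i as Z^neg plus an excess supported on ±i of total p − q and expanding
-- the rows one at a time gives exp(u(p − q)) / (1 − uq).

module Submission where

open import Defs
open import Algebra.Bundles using (CommutativeRing)
import Algebra.Construct.Pointwise as Pointwise
import Algebra.Properties.CommutativeSemigroup as CommutativeSemigroupProperties
import Algebra.Properties.Ring as RingProperties
import Algebra.Properties.Semiring.Exp as SemiringExp
import Algebra.Solver.Ring.NaturalCoefficients.Default as SemiringSolver
open import Data.Bool using (Bool; true; false; if_then_else_; not; _∧_)
open import Data.Integer as ℤ using (ℤ; +_; -[1+_]; ∣_∣)
import Data.Integer.Properties as ℤₚ
open import Data.List using (List; []; _∷_; _++_; _∷ʳ_; map; length; replicate; zipWith; filter; upTo; applyUpTo; concatMap)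
import Data.List.Properties as Listₚ
open import Data.List.Relation.Binary.Permutation.Propositional using (_↭_; ↭-refl; ↭-sym; ↭-trans; prep; swap; ↭⇒↭ₛ)
import Data.List.Relation.Binary.Permutation.Propositional.Properties as ↭ₚ
import Data.List.Relation.Binary.Permutation.Setoid.Properties as ↭Setoidₚ
open import Data.List.Relation.Unary.All as All using (All; []; _∷_)
import Data.List.Relation.Unary.All.Properties as Allₚ
open import Data.List.Relation.Unary.AllPairs as AllPairs using ([]; _∷_)
import Data.List.Relation.Unary.AllPairs.Properties as AllPairsₚ
open import Data.List.Relation.Unary.Unique.Propositional using (Unique)
import Data.List.Relation.Unary.Unique.Propositional.Properties as Uniqueₚ
import Data.List.Relation.Unary.Unique.DecPropositional as UniqueDec
open import Data.Nat as ℕ using (ℕ; zero; suc; _∸_; _!)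
import Data.Nat.Properties as ℕₚ
open import Data.Product using (_×_; _,_; proj₁; proj₂)
open import Data.Rational as ℚ using (ℚ; 0ℚ; 1ℚ; _/_)
import Data.Rational.Properties as ℚₚ
import Data.Rational.Unnormalised as ℚᵘ
import Data.Rational.Unnormalised.Properties as ℚᵘₚ
open import Data.Sum using (_⊎_; inj₁; inj₂)
open import Function using (_∘_; id)
open import Level using (0ℓ)
import Relation.Binary.Reasoning.Setoid as SetoidReasoning
open import Relation.Binary.PropositionalEquality as ≡ using (_≡_; _≢_)
open import Relation.Nullary using (does; yes; no; ¬?)
open import Relation.Nullary.Decidable using (dec-true; dec-false)
open import Relation.Unary using (Decidable)

open UniqueDec ℕ._≟_ using (unique?)

-- Finite sums and factorials in a commutative ring.

module RingKit {c ℓ} (R : CommutativeRing c ℓ) where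

  open CommutativeRing R public hiding (zero)
  open SemiringExp semiring public using (_^_; ^-congˡ)
  open SemiringSolver commutativeSemiring public using (solve; _:=_; _:+_; _:*_; con)
  open CommutativeSemigroupProperties +-commutativeSemigroup public
    using () renaming (interchange to +-interchange)

  module ≈-Reasoning = SetoidReasoning setoid

  fromℕ : ℕ → Carrier
  fromℕ zero    = 0#
  fromℕ (suc n) = 1# + fromℕ n

  fromℕ-+ : ∀ m n → fromℕ (m ℕ.+ n) ≈ fromℕ m + fromℕ n
  fromℕ-+ zero    n = sym (+-identityˡ _)
  fromℕ-+ (suc m) n = trans (+-congˡ (fromℕ-+ m n)) (sym (+-assoc _ _ _))

  fromℕ-* : ∀ m n → fromℕ (m ℕ.* n) ≈ fromℕ m * fromℕ n
  fromℕ-* zero    n = sym (zeroˡ _)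
  fromℕ-* (suc m) n = begin
    fromℕ (n ℕ.+ m ℕ.* n)        ≈⟨ fromℕ-+ n (m ℕ.* n) ⟩
    fromℕ n + fromℕ (m ℕ.* n)    ≈⟨ +-congˡ (fromℕ-* m n) ⟩
    fromℕ n + fromℕ m * fromℕ n  ≈⟨ solve 2 (λ x y → x :+ y :* x := (con 1 :+ y) :* x) refl (fromℕ n) (fromℕ m) ⟩
    fromℕ (suc m) * fromℕ n      ∎
    where open ≈-Reasoning

  -- The coefficient ring will itself be a ring of power series and not a field, so only inverses of
  -- factorials are demanded.
  InvertsFactorials : (ℕ → Carrier) → Set ℓ
  InvertsFactorials inv! = ∀ n → inv! n * fromℕ (n !) ≈ 1#

  ∑≤ : ℕ → (ℕ → Carrier) → Carrier
  ∑≤ zero    f = f zero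
  ∑≤ (suc n) f = ∑≤ n f + f (suc n)

  ∑≤-cong : ∀ n {f g} → (∀ i → i ℕ.≤ n → f i ≈ g i) → ∑≤ n f ≈ ∑≤ n g
  ∑≤-cong zero    e = e 0 ℕ.z≤n
  ∑≤-cong (suc n) e = +-cong (∑≤-cong n λ i i≤n → e i (ℕₚ.m≤n⇒m≤1+n i≤n)) (e (suc n) ℕₚ.≤-refl)

  ∑≤-suc : ∀ n f → ∑≤ (suc n) f ≈ f 0 + ∑≤ n (λ i → f (suc i))
  ∑≤-suc zero    f = refl
  ∑≤-suc (suc n) f = trans (+-congʳ (∑≤-suc n f)) (+-assoc _ _ _)

  ∑≤-*ˡ : ∀ n x f → ∑≤ n (λ i → x * f i) ≈ x * ∑≤ n f
  ∑≤-*ˡ zero    x f = refl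
  ∑≤-*ˡ (suc n) x f = trans (+-congʳ (∑≤-*ˡ n x f)) (sym (distribˡ _ _ _))

  ∑≤-const : ∀ n x → ∑≤ n (λ _ → x) ≈ fromℕ (suc n) * x
  ∑≤-const zero    x = sym (trans (*-congʳ (+-identityʳ _)) (*-identityˡ _))
  ∑≤-const (suc n) x = trans (+-congʳ (∑≤-const n x))
    (solve 2 (λ x k → k :* x :+ x := (con 1 :+ k) :* x) refl x (fromℕ (suc n)))

  ∑≤-0 : ∀ n {f} → (∀ i → f i ≈ 0#) → ∑≤ n f ≈ 0#
  ∑≤-0 zero    e = e 0
  ∑≤-0 (suc n) e = trans (+-cong (∑≤-0 n e) (e (suc n))) (+-identityˡ _)

  ∑ : ∀ {A : Set} → List A → (A → Carrier) → Carrier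
  ∑ []      f = 0#
  ∑ (x ∷ L) f = f x + ∑ L f

  ∑-cong : ∀ {A : Set} (L : List A) {f g} → (∀ x → f x ≈ g x) → ∑ L f ≈ ∑ L g
  ∑-cong []      e = refl
  ∑-cong (x ∷ L) e = +-cong (e x) (∑-cong L e)

  ∑-indicator : ∀ {A : Set} (p : A → Bool) L → ∑ L (λ x → if p x then 1# else 0#) ≈ fromℕ (count p L)
  ∑-indicator p []      = refl
  ∑-indicator p (x ∷ L) with p x
  ... | true  = +-congˡ (∑-indicator p L)
  ... | false = trans (+-identityˡ _) (∑-indicator p L)

-- Formal power series in one variable u.

module PowerSeries {c ℓ} (R : CommutativeRing c ℓ) where

  open RingKit R

  Series : Set c
  Series = ℕ → Carrier

  infix  4 _≋_
  infixl 7 _⊛_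

  _≋_ : Series → Series → Set ℓ
  f ≋ g = ∀ n → f n ≈ g n

  tail : Series → Series
  tail f n = f (suc n)

  _⊞_ : Series → Series → Series
  (f ⊞ g) n = f n + g n

  const : Carrier → Series
  const r zero    = r
  const r (suc n) = 0#

  -- The recursion f g = f₀ g + u (tail f) g makes the ring laws direct inductions;
  -- conv-∑ identifies it with the usual sum.
  _⊛_ : Series → Series → Series
  (f ⊛ g) zero    = f 0 * g 0
  (f ⊛ g) (suc n) = f 0 * g (suc n) + (tail f ⊛ g) n

  ⊛-cong : ∀ {f f′ g g′} → f ≋ f′ → g ≋ g′ → f ⊛ g ≋ f′ ⊛ g′
  ⊛-cong p q zero    = *-cong (p 0) (q 0)
  ⊛-cong p q (suc n) = +-cong (*-cong (p 0) (q (suc n))) (⊛-cong (λ i → p (suc i)) q n)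

  ⊛-distribʳ : ∀ h f g → (f ⊞ g) ⊛ h ≋ (f ⊛ h) ⊞ (g ⊛ h)
  ⊛-distribʳ h f g zero    = distribʳ _ _ _
  ⊛-distribʳ h f g (suc n) =
    trans (+-cong (distribʳ _ _ _) (⊛-distribʳ h (tail f) (tail g) n)) (+-interchange _ _ _ _)

  scale-⊛ : ∀ r f g → (λ n → r * f n) ⊛ g ≋ (λ n → r * (f ⊛ g) n)
  scale-⊛ r f g zero    = *-assoc _ _ _
  scale-⊛ r f g (suc n) =
    trans (+-cong (*-assoc _ _ _) (scale-⊛ r (tail f) g n)) (sym (distribˡ _ _ _))

  0-⊛ : ∀ f {g} → (∀ n → g n ≈ 0#) → ∀ n → (g ⊛ f) n ≈ 0#
  0-⊛ f e zero    = trans (*-congʳ (e 0)) (zeroˡ _)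
  0-⊛ f e (suc n) =
    trans (+-cong (trans (*-congʳ (e 0)) (zeroˡ _)) (0-⊛ f (λ i → e (suc i)) n)) (+-identityˡ _)

  const-⊛ : ∀ r f → const r ⊛ f ≋ (λ n → r * f n)
  const-⊛ r f zero    = refl
  const-⊛ r f (suc n) = trans (+-congˡ (0-⊛ f (λ _ → refl) n)) (+-identityʳ _)

  -- The recursion defining `⊛` splits off the constant term of the left factor; this mirror image
  -- splits off that of the right factor, which is what commutativity needs.
  ⊛-sucʳ : ∀ f g n → (f ⊛ g) (suc n) ≈ f (suc n) * g 0 + (f ⊛ tail g) n
  ⊛-sucʳ f g zero    = +-comm _ _
  ⊛-sucʳ f g (suc n) = begin
    f 0 * g (2 ℕ.+ n) + (tail f ⊛ g) (suc n)
      ≈⟨ +-congˡ (⊛-sucʳ (tail f) g n) ⟩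
    f 0 * g (2 ℕ.+ n) + (f (2 ℕ.+ n) * g 0 + (tail f ⊛ tail g) n)
      ≈⟨ solve 3 (λ x y z → x :+ (y :+ z) := y :+ (x :+ z)) refl _ _ _ ⟩
    f (2 ℕ.+ n) * g 0 + (f ⊛ tail g) (suc n) ∎
    where open ≈-Reasoning

  ⊛-comm : ∀ f g → f ⊛ g ≋ g ⊛ f
  ⊛-comm f g zero    = *-comm _ _
  ⊛-comm f g (suc n) =
    trans (+-cong (*-comm _ _) (⊛-comm (tail f) g n)) (sym (⊛-sucʳ g f n))

  ⊛-assoc : ∀ f g h → (f ⊛ g) ⊛ h ≋ f ⊛ (g ⊛ h)
  ⊛-assoc f g h zero    = *-assoc _ _ _
  ⊛-assoc f g h (suc n) = begin
    f 0 * g 0 * h (suc n) + (tail (f ⊛ g) ⊛ h) n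
      ≈⟨ +-cong (*-assoc _ _ _) (⊛-distribʳ h (λ i → f 0 * g (suc i)) (tail f ⊛ g) n) ⟩
    f 0 * (g 0 * h (suc n)) + (((λ i → f 0 * g (suc i)) ⊛ h) n + ((tail f ⊛ g) ⊛ h) n)
      ≈⟨ +-congˡ (+-cong (scale-⊛ (f 0) (tail g) h n) (⊛-assoc (tail f) g h n)) ⟩
    f 0 * (g 0 * h (suc n)) + (f 0 * (tail g ⊛ h) n + (tail f ⊛ (g ⊛ h)) n)
      ≈⟨ +-assoc _ _ _ ⟨
    f 0 * (g 0 * h (suc n)) + f 0 * (tail g ⊛ h) n + (tail f ⊛ (g ⊛ h)) n
      ≈⟨ +-congʳ (distribˡ _ _ _) ⟨
    f 0 * (g ⊛ h) (suc n) + (tail f ⊛ (g ⊛ h)) n ∎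
    where open ≈-Reasoning

  1-⊛ : ∀ f → const 1# ⊛ f ≋ f
  1-⊛ f n = trans (const-⊛ 1# f n) (*-identityˡ _)

  series : CommutativeRing c ℓ
  series = record
    { Carrier = Series
    ; _≈_ = _≋_
    ; _+_ = _⊞_
    ; _*_ = _⊛_
    ; -_ = λ f n → - f n
    ; 0# = λ _ → 0#
    ; 1# = const 1#
    ; isCommutativeRing = record
      { isRing = record
        { +-isAbelianGroup = Pointwise.isAbelianGroup ℕ +-isAbelianGroup
        ; *-cong = ⊛-cong
        ; *-assoc = ⊛-assoc
        ; *-identity = 1-⊛ , λ f n → trans (⊛-comm f (const 1#) n) (1-⊛ f n)
        ; distrib = (λ f g h n → trans (⊛-comm f (g ⊞ h) n) (trans (⊛-distribʳ f g h n)
                                   (+-cong (⊛-comm g f n) (⊛-comm h f n))))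
                    , ⊛-distribʳ
        }
      ; *-comm = ⊛-comm
      }
    }

  module S = RingKit series

  conv-∑ : ∀ f g n → (f ⊛ g) n ≈ ∑≤ n (λ i → f i * g (n ∸ i))
  conv-∑ f g zero    = refl
  conv-∑ f g (suc n) = trans (+-congˡ (conv-∑ (tail f) g n)) (sym (∑≤-suc n _))

  ∑≤-coeff : ∀ m (F : ℕ → Series) n → S.∑≤ m F n ≡ ∑≤ m (λ i → F i n)
  ∑≤-coeff zero    F n = ≡.refl
  ∑≤-coeff (suc m) F n = ≡.cong (_+ F (suc m) n) (∑≤-coeff m F n)

  ∑-coeff : ∀ {A : Set} (L : List A) (F : A → Series) n → S.∑ L F n ≡ ∑ L (λ x → F x n)
  ∑-coeff []      F n = ≡.refl
  ∑-coeff (x ∷ L) F n = ≡.cong (λ t → F x n + t) (∑-coeff L F n)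

  X : Series
  X 1 = 1#
  X _ = 0#

  X-⊛-zero : ∀ f → (X ⊛ f) 0 ≈ 0#
  X-⊛-zero f = zeroˡ _

  X-⊛-suc : ∀ f n → (X ⊛ f) (suc n) ≈ f n
  X-⊛-suc f n = trans (+-congʳ (zeroˡ _)) (trans (+-identityˡ _)
    (trans (⊛-cong {g = f} tail-X (λ _ → refl) n) (1-⊛ f n)))
    where
    tail-X : tail X ≋ const 1#
    tail-X zero    = refl
    tail-X (suc n) = refl

  const-cong : ∀ {r s} → r ≈ s → const r ≋ const s
  const-cong e zero    = e
  const-cong e (suc n) = refl

  const-+ : ∀ r s → const (r + s) ≋ const r ⊞ const s
  const-+ r s zero    = refl
  const-+ r s (suc n) = sym (+-identityˡ _)

  const-* : ∀ r s → const (r * s) ≋ const r ⊛ const s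
  const-* r s n = sym (trans (const-⊛ r (const s) n) (lem n))
    where
    lem : ∀ n → r * const s n ≈ const (r * s) n
    lem zero    = refl
    lem (suc n) = zeroʳ _

  const-^ : ∀ r n → const (r ^ n) ≋ const r S.^ n
  const-^ r zero    = λ _ → refl
  const-^ r (suc n) = S.trans (const-* r (r ^ n)) (S.*-congˡ (const-^ r n))

  const-fromℕ : ∀ n → const (fromℕ n) ≋ S.fromℕ n
  const-fromℕ zero zero    = refl
  const-fromℕ zero (suc n) = refl
  const-fromℕ (suc k)      = S.trans (const-+ 1# (fromℕ k)) (S.+-congˡ {const 1#} (const-fromℕ k))

  -- The formal derivative d/du.
  D : Series → Series
  D f n = fromℕ (suc n) * f (suc n)

  tail-D : ∀ f n → D f (suc n) ≈ f (2 ℕ.+ n) + D (tail f) n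
  tail-D f n = trans (distribʳ _ _ _) (+-congʳ (*-identityˡ _))

  -- The Leibniz rule, by induction on the degree: `tail-D` expresses `D f` through `D (tail f)`,
  -- and the recursion of `⊛` runs on `tail f`.
  D-⊛ : ∀ f g → D (f ⊛ g) ≋ (D f ⊛ g) ⊞ (f ⊛ D g)
  D-⊛ f g zero =
    solve 4 (λ a b c d → (con 1 :+ con 0) :* (a :* b :+ c :* d)
                     := ((con 1 :+ con 0) :* c) :* d :+ a :* ((con 1 :+ con 0) :* b))
      refl (f 0) (g 1) (f 1) (g 0)
  D-⊛ f g (suc n) = begin
    fromℕ (2 ℕ.+ n) * (f 0 * g (2 ℕ.+ n) + (tail f ⊛ g) (suc n))
      ≈⟨ solve 4 (λ k a b w → (con 1 :+ k) :* (a :* b :+ w) := (w :+ k :* w) :+ a :* ((con 1 :+ k) :* b))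
           refl (fromℕ (suc n)) (f 0) (g (2 ℕ.+ n)) ((tail f ⊛ g) (suc n)) ⟩
    ((tail f ⊛ g) (suc n) + D (tail f ⊛ g) n) + f 0 * D g (suc n)
      ≈⟨ +-congʳ (+-congˡ (D-⊛ (tail f) g n)) ⟩
    ((f 1 * g (suc n) + (tail (tail f) ⊛ g) n) + ((D (tail f) ⊛ g) n + (tail f ⊛ D g) n)) + f 0 * D g (suc n)
      ≈⟨ solve 5 (λ a b c d e → (a :+ b :+ (c :+ d)) :+ e := (a :+ (b :+ c)) :+ (e :+ d)) refl _ _ _ _ _ ⟩
    (f 1 * g (suc n) + ((tail (tail f) ⊛ g) n + (D (tail f) ⊛ g) n)) + (f ⊛ D g) (suc n)
      ≈⟨ +-congʳ (+-cong (*-congʳ (D0 f)) (trans (⊛-cong {g = g} (tail-D f) (λ _ → refl) n)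
                                  (⊛-distribʳ g (tail (tail f)) (D (tail f)) n))) ⟨
    (D f ⊛ g) (suc n) + (f ⊛ D g) (suc n) ∎
    where
    open ≈-Reasoning
    D0 : ∀ f → D f 0 ≈ f 1
    D0 f = trans (*-congʳ (+-identityʳ _)) (*-identityˡ _)

-- Exponential and geometric series.

module Exponential {c ℓ} (R : CommutativeRing c ℓ)
  (inv! : ℕ → RingKit.Carrier R) (inv!-inverse : RingKit.InvertsFactorials R inv!) where

  open RingKit R
  open PowerSeries R public

  cancel! : ∀ n {x y} → fromℕ (n !) * x ≈ fromℕ (n !) * y → x ≈ y
  cancel! n {x} {y} e = begin
    x                               ≈⟨ expand x ⟩
    inv! n * (fromℕ (n !) * x)      ≈⟨ *-congˡ e ⟩
    inv! n * (fromℕ (n !) * y)      ≈⟨ expand y ⟨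
    y                               ∎
    where
    open ≈-Reasoning
    expand : ∀ z → z ≈ inv! n * (fromℕ (n !) * z)
    expand z = sym (trans (sym (*-assoc _ _ _)) (trans (*-congʳ (inv!-inverse n)) (*-identityˡ z)))

  fromℕ-suc! : ∀ n x → fromℕ (suc n !) * x ≈ fromℕ (n !) * (fromℕ (suc n) * x)
  fromℕ-suc! n x = trans (*-congʳ (fromℕ-* (suc n) (n !)))
    (solve 3 (λ a b x → a :* b :* x := b :* (a :* x)) refl (fromℕ (suc n)) (fromℕ (n !)) x)

  inv!-suc : ∀ n → fromℕ (suc n) * inv! (suc n) ≈ inv! n
  inv!-suc n = cancel! n (trans (sym (fromℕ-suc! n _)) (trans (trans (*-comm _ _) (inv!-inverse (suc n)))
    (trans (sym (inv!-inverse n)) (*-comm _ _))))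

  inv!-zero : inv! 0 ≈ 1#
  inv!-zero = trans (sym (trans (*-congˡ (+-identityʳ _)) (*-identityʳ _))) (inv!-inverse 0)

  -- The series exp(au), with a in the coefficient ring.
  exp : Carrier → Series
  exp a n = inv! n * a ^ n

  exp-zero : ∀ a → exp a 0 ≈ 1#
  exp-zero a = trans (*-identityʳ _) inv!-zero

  D-exp : ∀ a n → D (exp a) n ≈ a * exp a n
  D-exp a n = trans (sym (*-assoc _ _ _)) (trans (*-congʳ (inv!-suc n))
    (solve 3 (λ i a b → i :* (a :* b) := a :* (i :* b)) refl (inv! n) a (a ^ n)))

  -- The differential equation f′ = af with f₀ = 1 forces n! fₙ = aⁿ, and n! can be cancelled.
  D-unique : ∀ a f → f 0 ≈ 1# → (∀ n → D f n ≈ a * f n) → f ≋ exp a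
  D-unique a f f0 Df n = cancel! n (trans (lem n) (sym (trans (sym (*-assoc _ _ _))
      (trans (*-congʳ (trans (*-comm _ _) (inv!-inverse n))) (*-identityˡ _)))))
    where
    open ≈-Reasoning
    lem : ∀ n → fromℕ (n !) * f n ≈ a ^ n
    lem zero    = trans (*-cong (+-identityʳ _) f0) (*-identityˡ _)
    lem (suc n) = begin
      fromℕ (suc n !) * f (suc n)    ≈⟨ fromℕ-suc! n _ ⟩
      fromℕ (n !) * D f n            ≈⟨ *-congˡ (Df n) ⟩
      fromℕ (n !) * (a * f n)        ≈⟨ solve 3 (λ x y z → x :* (y :* z) := y :* (x :* z)) refl _ _ _ ⟩
      a * (fromℕ (n !) * f n)        ≈⟨ *-congˡ (lem n) ⟩
      a * a ^ n                      ∎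

  -- By the Leibniz rule the product solves f′ = (a + b)f with constant term 1, which determines it.
  exp-+ : ∀ a b → exp a ⊛ exp b ≋ exp (a + b)
  exp-+ a b = D-unique (a + b) (exp a ⊛ exp b)
    (trans (*-cong (exp-zero a) (exp-zero b)) (*-identityˡ _))
    λ n → begin
      D (exp a ⊛ exp b) n
        ≈⟨ D-⊛ (exp a) (exp b) n ⟩
      (D (exp a) ⊛ exp b) n + (exp a ⊛ D (exp b)) n
        ≈⟨ +-cong (⊛-cong {g = exp b} (D-exp a) (λ _ → refl) n)
                  (trans (⊛-comm (exp a) (D (exp b)) n) (⊛-cong {g = exp a} (D-exp b) (λ _ → refl) n)) ⟩
      ((λ i → a * exp a i) ⊛ exp b) n + ((λ i → b * exp b i) ⊛ exp a) n
        ≈⟨ +-cong (scale-⊛ a (exp a) (exp b) n)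
                  (trans (scale-⊛ b (exp b) (exp a) n) (*-congˡ (⊛-comm (exp b) (exp a) n))) ⟩
      a * (exp a ⊛ exp b) n + b * (exp a ⊛ exp b) n
        ≈⟨ distribʳ _ _ _ ⟨
      (a + b) * (exp a ⊛ exp b) n ∎
    where open ≈-Reasoning

  exp-cong : ∀ {a b} → a ≈ b → exp a ≋ exp b
  exp-cong e n = *-congˡ (^-congˡ n e)

  exp-0 : exp 0# ≋ const 1#
  exp-0 zero    = exp-zero 0#
  exp-0 (suc n) = trans (*-congˡ (zeroˡ _)) (zeroʳ _)

  -- The geometric series 1/(1 - qu).
  geo : Carrier → Series
  geo q n = q ^ n

  geo-inverse : ∀ q → geo q ⊛ (const 1# ⊞ (λ n → - (X ⊛ const q) n)) ≋ const 1#
  geo-inverse q n = begin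
    (geo q S.* (S.1# S.+ S.- (X S.* const q))) n
      ≈⟨ S.distribˡ (geo q) S.1# (S.- (X S.* const q)) n ⟩
    (geo q S.* S.1#) n + (geo q S.* S.- (X S.* const q)) n
      ≈⟨ +-cong (S.*-identityʳ (geo q) n) (S.sym (RingProperties.-‿distribʳ-* S.ring (geo q) (X ⊛ const q)) n) ⟩
    geo q n + - (geo q S.* (X S.* const q)) n
      ≈⟨ +-congˡ (-‿cong (rearrange n)) ⟩
    geo q n + - (X S.* (λ i → q * geo q i)) n
      ≈⟨ cases n ⟩
    const 1# n ∎
    where
    open ≈-Reasoning
    rearrange : geo q ⊛ (X ⊛ const q) ≋ X ⊛ (λ i → q * geo q i)
    rearrange = S.trans (S.solve 3 (λ g x c → g S.:* (x S.:* c) S.:= x S.:* (c S.:* g)) S.refl (geo q) X (const q))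
                        (S.*-congˡ {X} (const-⊛ q (geo q)))
    cases : ∀ n → geo q n + - (X ⊛ (λ i → q * geo q i)) n ≈ const 1# n
    cases zero    = trans (+-congˡ (trans (-‿cong (zeroˡ _)) (RingProperties.-0#≈0# ring))) (+-identityʳ _)
    cases (suc n) = trans (+-congˡ (-‿cong (X-⊛-suc (λ i → q * geo q i) n))) (-‿inverseʳ _)

-- Words as signed arrangements of a list of labels.

Unique-↭ : ∀ {xs ys : List ℕ} → xs ↭ ys → Unique xs → Unique ys
Unique-↭ p = ↭Setoidₚ.Unique-resp-↭ (≡.setoid ℕ) (↭⇒↭ₛ p)

-- The label a stands for the letters ±(a+1).
_IsSignedArrangementOf_ : List ℤ → List ℕ → Set
w IsSignedArrangementOf A = map ∣_∣ w ↭ map suc A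

arrangement-length : ∀ {w A} → w IsSignedArrangementOf A → length w ≡ length A
arrangement-length {w} {A} p = ≡.trans (≡.sym (Listₚ.length-map ∣_∣ w))
  (≡.trans (↭ₚ.↭-length p) (Listₚ.length-map suc A))

arrangement-unique : ∀ {w A} → Unique A → w IsSignedArrangementOf A → Unique w
arrangement-unique u p = AllPairs.map (λ ne e → ne (≡.cong ∣_∣ e))
  (AllPairsₚ.map⁻ (Unique-↭ (↭-sym p) (Uniqueₚ.map⁺ ℕₚ.suc-injective u)))

-- Moves the first letter past the next i letters, stopping at the end of a shorter word.
rot : ℕ → List ℤ → List ℤ
rot (suc i) (x ∷ y ∷ w) = y ∷ rot i (x ∷ w)
rot _       w           = w

rot-[] : ∀ i → rot i [] ≡ []
rot-[] zero    = ≡.refl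
rot-[] (suc i) = ≡.refl

rot-singleton : ∀ i x → rot i (x ∷ []) ≡ x ∷ []
rot-singleton zero    x = ≡.refl
rot-singleton (suc i) x = ≡.refl

-- Sums over signed arrangements and their exponential generating functions.

module Arrangements {c ℓ} (R : CommutativeRing c ℓ)
  (inv! : ℕ → RingKit.Carrier R) (inv!-inverse : RingKit.InvertsFactorials R inv!) where

  open RingKit R
  open Exponential R inv! inv!-inverse
  open ≈-Reasoning

  -- Ranges over the ways to remove one entry `a` from the list, `B` being what remains in its
  -- original order.
  pick : List ℕ → (ℕ → List ℕ → Carrier) → Carrier
  pick []      h = 0#
  pick (a ∷ A) h = h a A + pick A (λ b B → h b (a ∷ B))

  pick-cong : ∀ A {h k} → (∀ {a B} → a ∷ B ↭ A → h a B ≈ k a B) → pick A h ≈ pick A k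
  pick-cong []      e = refl
  pick-cong (a ∷ A) e =
    +-cong (e ↭-refl) (pick-cong A λ {b} {B} p → e (↭-trans (swap b a ↭-refl) (prep a p)))

  pick-+ : ∀ A h k → pick A (λ a B → h a B + k a B) ≈ pick A h + pick A k
  pick-+ []      h k = sym (+-identityˡ _)
  pick-+ (a ∷ A) h k = trans (+-congˡ (pick-+ A _ _)) (+-interchange _ _ _ _)

  pick-*ˡ : ∀ A x h → pick A (λ a B → x * h a B) ≈ x * pick A h
  pick-*ˡ []      x h = sym (zeroʳ _)
  pick-*ˡ (a ∷ A) x h = trans (+-congˡ (pick-*ˡ A x _)) (sym (distribˡ _ _ _))

  pick-const : ∀ A x → pick A (λ _ _ → x) ≈ fromℕ (length A) * x
  pick-const []      x = sym (zeroˡ _)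
  pick-const (a ∷ A) x = trans (+-cong (sym (*-identityˡ _)) (pick-const A x)) (sym (distribʳ _ _ _))

  -- What remains after removing two entries does not depend on the order of removal. In the
  -- induction the pairs with `x` first and those with `x` second trade places.
  pick-swap : ∀ A (h : ℕ → ℕ → List ℕ → Carrier) →
    pick A (λ a B → pick B (λ b C → h a b C)) ≈ pick A (λ a B → pick B (λ b C → h b a C))
  pick-swap []      h = refl
  pick-swap (x ∷ A) h = begin
    pick A (h x) + pick A (λ a B → h a x B + pick B (λ b C → h a b (x ∷ C)))
      ≈⟨ +-congˡ (pick-+ A _ _) ⟩
    pick A (h x) + (pick A (λ a B → h a x B) + pick A (λ a B → pick B (λ b C → h a b (x ∷ C))))
      ≈⟨ solve 3 (λ a b c → a :+ (b :+ c) := b :+ (a :+ c)) refl _ _ _ ⟩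
    pick A (λ a B → h a x B) + (pick A (h x) + pick A (λ a B → pick B (λ b C → h a b (x ∷ C))))
      ≈⟨ +-congˡ (+-congˡ (pick-swap A (λ a b C → h a b (x ∷ C)))) ⟩
    pick A (λ a B → h a x B) + (pick A (h x) + pick A (λ a B → pick B (λ b C → h b a (x ∷ C))))
      ≈⟨ +-congˡ (pick-+ A _ _) ⟨
    pick A (λ a B → h a x B) + pick A (λ a B → h x a B + pick B (λ b C → h b a (x ∷ C))) ∎

  signed : ℕ → (ℤ → Carrier) → Carrier
  signed a h = h (+ suc a) + h -[1+ a ]

  signed-cong : ∀ a {h k} → (∀ x → ∣ x ∣ ≡ suc a → h x ≈ k x) → signed a h ≈ signed a k
  signed-cong a e = +-cong (e _ ≡.refl) (e _ ≡.refl)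

  -- Meaningful only for length A ≡ n.
  ∑arr : ℕ → List ℕ → (List ℤ → Carrier) → Carrier
  ∑arr zero    A f = f []
  ∑arr (suc n) A f = pick A λ a B → signed a λ x → ∑arr n B λ w → f (x ∷ w)

  ∑arr-cong : ∀ n A {f g} → length A ≡ n →
    (∀ w → w IsSignedArrangementOf A → f w ≈ g w) → ∑arr n A f ≈ ∑arr n A g
  ∑arr-cong zero    []      l e = e [] ↭-refl
  ∑arr-cong (suc n) A       l e = pick-cong A λ {a} {B} p → signed-cong a λ x x≡ →
    ∑arr-cong n B (ℕₚ.suc-injective (≡.trans (↭ₚ.↭-length p) l)) λ w q → e (x ∷ w)
      (≡.subst (λ k → k ∷ map ∣_∣ w ↭ map suc A) (≡.sym x≡) (↭-trans (prep (suc a) q) (↭ₚ.map⁺ suc p)))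

  ∑arr-cong′ : ∀ n A {f g} → (∀ w → f w ≈ g w) → ∑arr n A f ≈ ∑arr n A g
  ∑arr-cong′ zero    A e = e []
  ∑arr-cong′ (suc n) A e = pick-cong A λ {a} {B} _ → signed-cong a λ x _ → ∑arr-cong′ n B λ w → e (x ∷ w)

  ∑arr-+ : ∀ n A f g → ∑arr n A (λ w → f w + g w) ≈ ∑arr n A f + ∑arr n A g
  ∑arr-+ zero    A f g = refl
  ∑arr-+ (suc n) A f g = trans
    (pick-cong A λ {a} {B} _ → trans (+-cong (∑arr-+ n B _ _) (∑arr-+ n B _ _)) (+-interchange _ _ _ _))
    (pick-+ A _ _)

  ∑arr-*ˡ : ∀ n A x f → ∑arr n A (λ w → x * f w) ≈ x * ∑arr n A f
  ∑arr-*ˡ zero    A x f = refl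
  ∑arr-*ˡ (suc n) A x f = trans
    (pick-cong A λ {a} {B} _ → trans (+-cong (∑arr-*ˡ n B x _) (∑arr-*ˡ n B x _)) (sym (distribˡ _ _ _)))
    (pick-*ˡ A x _)

  ∑arr-∑≤ : ∀ n A m (F : ℕ → List ℤ → Carrier) → ∑arr n A (λ w → ∑≤ m (λ i → F i w)) ≈ ∑≤ m (λ i → ∑arr n A (F i))
  ∑arr-∑≤ n A zero    F = refl
  ∑arr-∑≤ n A (suc m) F = trans (∑arr-+ n A _ _) (+-congʳ (∑arr-∑≤ n A m F))

  -- Exchanging the first two letters permutes the arrangements; on the labels this is `pick-swap`,
  -- on the signs an interchange of two double sums.
  ∑arr-swap : ∀ n A f → ∑arr n A f ≈ ∑arr n A (f ∘ rot 1)
  ∑arr-swap zero          A f = refl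
  ∑arr-swap (suc zero)    A f = refl
  ∑arr-swap (suc (suc n)) A f = begin
    pick A (λ a B → signed a λ x → pick B λ b C → signed b λ y → G x y C)
      ≈⟨ pick-cong A (λ {a} {B} _ → sym (pick-+ B _ _)) ⟩
    pick A (λ a B → pick B λ b C → signed a λ x → signed b λ y → G x y C)
      ≈⟨ pick-swap A _ ⟩
    pick A (λ a B → pick B λ b C → signed b λ x → signed a λ y → G x y C)
      ≈⟨ pick-cong A (λ {a} {B} _ → pick-cong B λ _ → +-interchange _ _ _ _) ⟩
    pick A (λ a B → pick B λ b C → signed a λ x → signed b λ y → G y x C)
      ≈⟨ pick-cong A (λ {a} {B} _ → pick-+ B _ _) ⟩
    pick A (λ a B → signed a λ x → pick B λ b C → signed b λ y → G y x C) ∎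
    where
    G : ℤ → ℤ → List ℕ → Carrier
    G x y C = ∑arr n C λ w → f (x ∷ y ∷ w)

  -- A rotation is a product of adjacent transpositions: `rot (suc i)` exchanges the first two
  -- letters and then applies `rot i` behind the first one.
  ∑arr-rot : ∀ i n A f → ∑arr n A f ≈ ∑arr n A (f ∘ rot i)
  ∑arr-rot zero    n       A f = refl
  ∑arr-rot (suc i) zero    A f = refl
  ∑arr-rot (suc i) (suc n) A f = begin
    ∑arr (suc n) A f              ≈⟨ pick-cong A (λ {a} {B} _ → signed-cong a λ x _ → ∑arr-rot i n B λ w → f (x ∷ w)) ⟩
    ∑arr (suc n) A g              ≈⟨ ∑arr-swap (suc n) A g ⟩
    ∑arr (suc n) A (g ∘ rot 1)    ≈⟨ ∑arr-cong′ (suc n) A lem ⟩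
    ∑arr (suc n) A (f ∘ rot (suc i)) ∎
    where
    g : List ℤ → Carrier
    g []      = f []
    g (x ∷ w) = f (x ∷ rot i w)
    lem : ∀ w → g (rot 1 w) ≈ f (rot (suc i) w)
    lem []          = refl
    lem (x ∷ [])    = reflexive (≡.cong (λ v → f (x ∷ v)) (rot-[] i))
    lem (x ∷ y ∷ w) = refl

  ∑arr-first : ∀ n A (f : List ℤ → Carrier) {g : List ℤ → Carrier} (φ : ℤ → Carrier) → (∀ x w → f (x ∷ w) ≈ φ x * g w) →
    ∑arr (suc n) A f ≈ pick A (λ a B → signed a φ * ∑arr n B g)
  ∑arr-first n A f φ e = pick-cong A λ {a} {B} _ → trans
    (signed-cong a λ x _ → trans (∑arr-cong′ n B (e x)) (∑arr-*ˡ n B (φ x) _))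
    (sym (distribʳ _ _ _))

  -- `H` is the exponential generating function of `h`. Quantifying over every list of distinct
  -- labels allows passing to the labels left after some letters are removed.
  Average : (List ℤ → Carrier) → Series → Set ℓ
  Average h H = ∀ n A → Unique A → length A ≡ n → ∑arr n A h ≈ fromℕ (n !) * H n

  Average-cong : ∀ {f g H} → (∀ w → Unique w → f w ≈ g w) → Average f H → Average g H
  Average-cong e av n A u l =
    trans (∑arr-cong n A l λ w p → sym (e w (arrangement-unique u p))) (av n A u l)

  -- Each of the n + 1 labels available for the first letter contributes the same amount: total
  -- weight `p` over its two signs, times the common value `v` for the remaining labels.
  ∑arr-first-const : ∀ n A (f : List ℤ → Carrier) {g : List ℤ → Carrier} (φ : ℤ → Carrier) {p v} →
    (∀ x w → f (x ∷ w) ≈ φ x * g w) → (∀ a → signed a φ ≈ p) → Unique A → length A ≡ suc n →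
    (∀ B → Unique B → length B ≡ n → ∑arr n B g ≈ v) → ∑arr (suc n) A f ≈ fromℕ (suc n) * (p * v)
  ∑arr-first-const n A f φ {p} {v} e s u l ih = begin
    ∑arr (suc n) A f
      ≈⟨ ∑arr-first n A f φ e ⟩
    pick A (λ a B → signed a φ * ∑arr n B _)
      ≈⟨ pick-cong A (λ {a} {B} q → *-cong (s a)
           (ih B (AllPairs.tail (Unique-↭ (↭-sym q) u)) (ℕₚ.suc-injective (≡.trans (↭ₚ.↭-length q) l)))) ⟩
    pick A (λ _ _ → p * v)
      ≈⟨ pick-const A _ ⟩
    fromℕ (length A) * (p * v)
      ≈⟨ *-congʳ (reflexive (≡.cong fromℕ l)) ⟩
    fromℕ (suc n) * (p * v) ∎

  -- Cutting off a monotone prefix.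

  ⟦_⟧ : Bool → Carrier
  ⟦ true ⟧  = 1#
  ⟦ false ⟧ = 0#

  -- x ⊏ y will be x < y for the increasing prefix and x > y for the decreasing run.
  module Chain (_⊏_ : ℤ → ℤ → Bool)
    (⊏-total : ∀ {x y} → x ≢ y → y ⊏ x ≡ not (x ⊏ y))
    (⊏-trans : ∀ x y z → x ⊏ y ≡ true → y ⊏ z ≡ true → x ⊏ z ≡ true)
    (wt : ℤ → Carrier) where

    -- Cuts off j letters, weighted by `wt`, that continue a chain whose last letter is `m`, and
    -- evaluates `h` on the rest; a word with fewer than j letters gives 0.
    chainFrom : ℕ → ℤ → (List ℤ → Carrier) → List ℤ → Carrier
    chainFrom zero    m h w       = h w
    chainFrom (suc j) m h []      = 0#
    chainFrom (suc j) m h (x ∷ w) = ⟦ m ⊏ x ⟧ * (wt x * chainFrom j x h w)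

    chain : ℕ → (List ℤ → Carrier) → List ℤ → Carrier
    chain zero    h w       = h w
    chain (suc j) h []      = 0#
    chain (suc j) h (x ∷ w) = wt x * chainFrom j x h w

    chainSum : (List ℤ → Carrier) → List ℤ → Carrier
    chainSum h w = ∑≤ (length w) (λ j → chain j h w)

    chainFromSum : ℤ → (List ℤ → Carrier) → List ℤ → Carrier
    chainFromSum m h w = ∑≤ (length w) (λ j → chainFrom j m h w)

    chainSum-∷ : ∀ h x w → chainSum h (x ∷ w) ≈ h (x ∷ w) + wt x * chainFromSum x h w
    chainSum-∷ h x w = trans (∑≤-suc (length w) (λ j → chain j h (x ∷ w)))
                             (+-congˡ (∑≤-*ˡ (length w) (wt x) (λ j → chainFrom j x h w)))

    chainFromSum-⊏ : ∀ m h x w → m ⊏ x ≡ true → chainFromSum m h (x ∷ w) ≈ chainSum h (x ∷ w)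
    chainFromSum-⊏ m h x w e = ∑≤-cong (suc (length w)) λ where
      zero    _ → refl
      (suc j) _ → trans (*-congʳ (reflexive (≡.cong ⟦_⟧ e))) (*-identityˡ _)

    -- Every cut after at least one letter fails at its first comparison, so only j = 0 survives.
    chainFromSum-⋢ : ∀ m h x w → m ⊏ x ≡ false → chainFromSum m h (x ∷ w) ≈ h (x ∷ w)
    chainFromSum-⋢ m h x w e = trans (∑≤-suc (length w) (λ j → chainFrom j m h (x ∷ w)))
      (trans (+-congˡ (∑≤-0 (length w) λ j → trans (*-congʳ (reflexive (≡.cong ⟦_⟧ e))) (zeroˡ _)))
             (+-identityʳ _))

    private
      -- If `x` and `y` both lie beyond `m`, exactly one of the orders m, x, y and m, y, x is a
      -- chain. Otherwise neither is, since a chain would by transitivity put both beyond `m`.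
      insertion : ∀ {m x y} t → x ≢ y →
        ⟦ m ⊏ x ⟧ * (⟦ x ⊏ y ⟧ * t) + ⟦ m ⊏ y ⟧ * (⟦ y ⊏ x ⟧ * t) ≈ ⟦ m ⊏ x ⟧ * (⟦ m ⊏ y ⟧ * t)
      insertion {m} {x} {y} t ne
        with m ⊏ x | x ⊏ y | m ⊏ y | y ⊏ x | ⊏-total ne | ⊏-trans m x y | ⊏-trans m y x
      ... | true  | true  | true  | .false | ≡.refl | _ | _ =
              solve 1 (λ t → con 1 :* (con 1 :* t) :+ con 1 :* (con 0 :* t) := con 1 :* (con 1 :* t)) refl t
      ... | true  | true  | false | _      | ≡.refl | h | _ with () ← h ≡.refl ≡.refl
      ... | true  | false | true  | .true  | ≡.refl | _ | _ =
              solve 1 (λ t → con 1 :* (con 0 :* t) :+ con 1 :* (con 1 :* t) := con 1 :* (con 1 :* t)) refl t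
      ... | true  | false | false | .true  | ≡.refl | _ | _ =
              solve 1 (λ t → con 1 :* (con 0 :* t) :+ con 0 :* (con 1 :* t) := con 1 :* (con 0 :* t)) refl t
      ... | false | true  | b     | .false | ≡.refl | _ | _ =
              solve 2 (λ t b → con 0 :* (con 1 :* t) :+ b :* (con 0 :* t) := con 0 :* (b :* t)) refl t ⟦ b ⟧
      ... | false | false | true  | .true  | ≡.refl | _ | h with () ← h ≡.refl ≡.refl
      ... | false | false | false | .true  | ≡.refl | _ | _ =
              solve 1 (λ t → con 0 :* (con 0 :* t) :+ con 0 :* (con 1 :* t) := con 0 :* (con 0 :* t)) refl t

    -- Exactly one position in a chain can receive a new letter x.
    chainFrom-rot : ∀ j m h x w → All (x ≢_) w →
      ∑≤ j (λ i → chainFrom (suc j) m h (rot i (x ∷ w))) ≈ ⟦ m ⊏ x ⟧ * (wt x * chainFrom j m h w)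
    chainFrom-rot zero    m h x w  ne = refl
    chainFrom-rot (suc j) m h x [] ne = trans
      (∑≤-0 (suc j) λ i → trans (reflexive (≡.cong (chainFrom (suc (suc j)) m h) (rot-singleton i x)))
        (trans (*-congˡ (zeroʳ _)) (zeroʳ _)))
      (sym (trans (*-congˡ (zeroʳ _)) (zeroʳ _)))
    chainFrom-rot (suc j) m h x (y ∷ w) (x≢y ∷ ne) = begin
      ∑≤ (suc j) (λ i → chainFrom (suc (suc j)) m h (rot i (x ∷ y ∷ w)))
        ≈⟨ ∑≤-suc j _ ⟩
      -- `first` leaves `x` in front of `y`; the other positions have `y` in front, and there `x` is
      -- inserted into a chain starting from `y`.
      first + ∑≤ j (λ i → ⟦ m ⊏ y ⟧ * (wt y * chainFrom (suc j) y h (rot i (x ∷ w))))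
        ≈⟨ +-congˡ (trans (∑≤-*ˡ j _ _) (*-congˡ (trans (∑≤-*ˡ j _ _) (*-congˡ (chainFrom-rot j y h x w ne))))) ⟩
      first + ⟦ m ⊏ y ⟧ * (wt y * (⟦ y ⊏ x ⟧ * (wt x * chainFrom j y h w)))
        ≈⟨ solve 7 (λ a b c d p q k → a :* (p :* (b :* (q :* k))) :+ c :* (q :* (d :* (p :* k)))
                    := a :* (b :* (p :* (q :* k))) :+ c :* (d :* (p :* (q :* k)))) refl _ _ _ _ _ _ _ ⟩
      ⟦ m ⊏ x ⟧ * (⟦ x ⊏ y ⟧ * (wt x * (wt y * k))) + ⟦ m ⊏ y ⟧ * (⟦ y ⊏ x ⟧ * (wt x * (wt y * k)))
        ≈⟨ insertion _ x≢y ⟩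
      ⟦ m ⊏ x ⟧ * (⟦ m ⊏ y ⟧ * (wt x * (wt y * k)))
        ≈⟨ solve 4 (λ a c p r → a :* (c :* (p :* r)) := a :* (p :* (c :* r))) refl _ _ _ _ ⟩
      ⟦ m ⊏ x ⟧ * (wt x * (⟦ m ⊏ y ⟧ * (wt y * k))) ∎
      where
      k first : Carrier
      k     = chainFrom j y h w
      first = ⟦ m ⊏ x ⟧ * (wt x * (⟦ x ⊏ y ⟧ * (wt y * k)))

    -- As in `chainFrom-rot`, but with no preceding letter: totality of the order on `x` and `y`
    -- takes the place of `insertion`.
    chain-rot : ∀ j h x w → All (x ≢_) w →
      ∑≤ j (λ i → chain (suc j) h (rot i (x ∷ w))) ≈ wt x * chain j h w
    chain-rot zero    h x w  ne = refl
    chain-rot (suc j) h x [] ne = trans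
      (∑≤-0 (suc j) λ i → trans (reflexive (≡.cong (chain (suc (suc j)) h) (rot-singleton i x)))
        (zeroʳ _))
      (sym (zeroʳ _))
    chain-rot (suc j) h x (y ∷ w) (x≢y ∷ ne) = begin
      ∑≤ (suc j) (λ i → chain (suc (suc j)) h (rot i (x ∷ y ∷ w)))
        ≈⟨ ∑≤-suc j _ ⟩
      first + ∑≤ j (λ i → wt y * chainFrom (suc j) y h (rot i (x ∷ w)))
        ≈⟨ +-congˡ (trans (∑≤-*ˡ j _ _) (*-congˡ (chainFrom-rot j y h x w ne))) ⟩
      first + wt y * (⟦ y ⊏ x ⟧ * (wt x * chainFrom j y h w))
        ≈⟨ solve 5 (λ b d p q k → p :* (b :* (q :* k)) :+ q :* (d :* (p :* k))
                    := (b :+ d) :* (p :* (q :* k))) refl _ _ _ _ _ ⟩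
      (⟦ x ⊏ y ⟧ + ⟦ y ⊏ x ⟧) * (wt x * (wt y * k))
        ≈⟨ trans (*-congʳ one) (*-identityˡ _) ⟩
      wt x * (wt y * k) ∎
      where
      k first : Carrier
      k     = chainFrom j y h w
      first = wt x * (⟦ x ⊏ y ⟧ * (wt y * k))
      one : ⟦ x ⊏ y ⟧ + ⟦ y ⊏ x ⟧ ≈ 1#
      one with x ⊏ y | y ⊏ x | ⊏-total x≢y
      ... | true  | .false | ≡.refl = +-identityʳ _
      ... | false | .true  | ≡.refl = +-identityˡ _

    -- Keeping j! on the left avoids division in the induction. As `∑arr` is invariant under `rot`,
    -- the j + 1 copies of the sum can be replaced by the j + 1 positions to which the first letter
    -- is moved. `chain-rot` merges these into an unconstrained first letter times a chain of length
    -- j.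
    chain-average : ∀ {p} → (∀ a → signed a wt ≈ p) → ∀ {h H} → Average h H →
      ∀ j m A → Unique A → length A ≡ j ℕ.+ m →
      fromℕ (j !) * ∑arr (j ℕ.+ m) A (chain j h) ≈ fromℕ ((j ℕ.+ m) !) * (p ^ j * H m)
    chain-average sp av zero m A u l = trans (*-cong (+-identityʳ _) (av m A u l))
      (solve 2 (λ a b → con 1 :* (a :* b) := a :* (con 1 :* b)) refl _ _)
    chain-average {p} sp {h} {H} av (suc j) m A u l = begin
      fromℕ (suc j !) * ∑arr (suc n) A (chain (suc j) h)
        ≈⟨ fromℕ-suc! j _ ⟩
      fromℕ (j !) * (fromℕ (suc j) * ∑arr (suc n) A (chain (suc j) h))
        ≈⟨ *-congˡ (∑≤-const j _) ⟨
      fromℕ (j !) * ∑≤ j (λ _ → ∑arr (suc n) A (chain (suc j) h))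
        ≈⟨ *-congˡ (∑≤-cong j λ i _ → ∑arr-rot i (suc n) A (chain (suc j) h)) ⟩
      fromℕ (j !) * ∑≤ j (λ i → ∑arr (suc n) A (chain (suc j) h ∘ rot i))
        ≈⟨ *-congˡ (∑arr-∑≤ (suc n) A j (λ i → chain (suc j) h ∘ rot i)) ⟨
      fromℕ (j !) * ∑arr (suc n) A (λ w → ∑≤ j (λ i → chain (suc j) h (rot i w)))
        ≈⟨ *-congˡ (∑arr-cong (suc n) A l λ w q → insert w (arrangement-unique u q)) ⟩
      fromℕ (j !) * ∑arr (suc n) A g
        ≈⟨ ∑arr-*ˡ (suc n) A _ g ⟨
      ∑arr (suc n) A (λ w → fromℕ (j !) * g w)
        ≈⟨ ∑arr-first-const n A (λ w → fromℕ (j !) * g w) wt (λ x w → solve 3 (λ a b c → a :* (b :* c) := b :* (a :* c)) refl _ _ _)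
             sp u l (λ B u′ l′ → trans (∑arr-*ˡ n B _ (chain j h)) (chain-average sp {H = H} av j m B u′ l′)) ⟩
      fromℕ (suc n) * (p * (fromℕ (n !) * (p ^ j * H m)))
        ≈⟨ solve 5 (λ a b c d e → a :* (b :* (c :* (d :* e))) := c :* (a :* (b :* d :* e))) refl _ _ _ _ _ ⟩
      fromℕ (n !) * (fromℕ (suc n) * (p ^ suc j * H m))
        ≈⟨ fromℕ-suc! n _ ⟨
      fromℕ (suc n !) * (p ^ suc j * H m) ∎
      where
      n = j ℕ.+ m
      g : List ℤ → Carrier
      g []      = 0#
      g (x ∷ w) = wt x * chain j h w
      insert : ∀ w → Unique w → ∑≤ j (λ i → chain (suc j) h (rot i w)) ≈ g w
      insert []      _        = ∑≤-0 j λ i → reflexive (≡.cong (chain (suc j) h) (rot-[] i))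
      insert (x ∷ w) (ne ∷ _) = chain-rot j h x w ne

    -- After division by j!, the cut of length j contributes n! (pʲ/j!) H(n - j), a term of the
    -- convolution of `exp p` with `H`.
    chainSum-average : ∀ {p} → (∀ a → signed a wt ≈ p) → ∀ {h H} →
      Average h H → Average (chainSum h) (exp p ⊛ H)
    chainSum-average {p} sp {h} {H} av n A u l = begin
      ∑arr n A (chainSum h)
        ≈⟨ ∑arr-cong n A l (λ w q → reflexive
             (≡.cong (λ k → ∑≤ k (λ j → chain j h w)) (≡.trans (arrangement-length q) l))) ⟩
      ∑arr n A (λ w → ∑≤ n (λ j → chain j h w))
        ≈⟨ ∑arr-∑≤ n A n (λ j → chain j h) ⟩
      ∑≤ n (λ j → ∑arr n A (chain j h))
        ≈⟨ ∑≤-cong n term ⟩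
      ∑≤ n (λ j → fromℕ (n !) * (exp p j * H (n ∸ j)))
        ≈⟨ ∑≤-*ˡ n _ _ ⟩
      fromℕ (n !) * ∑≤ n (λ j → exp p j * H (n ∸ j))
        ≈⟨ *-congˡ (conv-∑ (exp p) H n) ⟨
      fromℕ (n !) * (exp p ⊛ H) n ∎
      where
      term : ∀ j → j ℕ.≤ n → ∑arr n A (chain j h) ≈ fromℕ (n !) * (exp p j * H (n ∸ j))
      -- Matching on the equation turns `n` into `j + m`, the shape in which `chain-average` is
      -- stated.
      term j j≤n with n ∸ j | ℕₚ.m+[n∸m]≡n j≤n
      ... | m | ≡.refl = cancel! j (begin
        fromℕ (j !) * ∑arr n A (chain j h)
          ≈⟨ chain-average sp {H = H} av j m A u l ⟩
        fromℕ (n !) * (p ^ j * H m)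
          ≈⟨ *-identityˡ _ ⟨
        1# * (fromℕ (n !) * (p ^ j * H m))
          ≈⟨ *-congʳ (inv!-inverse j) ⟨
        inv! j * fromℕ (j !) * (fromℕ (n !) * (p ^ j * H m))
          ≈⟨ solve 5 (λ i f k a b → i :* f :* (k :* (a :* b)) := f :* (k :* (i :* a :* b))) refl _ _ _ _ _ ⟩
        fromℕ (j !) * (fromℕ (n !) * (exp p j * H m)) ∎)

-- The order on letters, desarrangements and the pixed factorization.

true⊎false : ∀ b → b ≡ true ⊎ b ≡ false
true⊎false true  = inj₁ ≡.refl
true⊎false false = inj₂ ≡.refl

even-suc : ∀ n → even (suc n) ≡ not (even n)
even-suc zero          = ≡.refl
even-suc (suc zero)    = ≡.refl
even-suc (suc (suc n)) = even-suc n

infix 5 _<ᵇ_ _>ᵇ_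

_<ᵇ_ _>ᵇ_ : ℤ → ℤ → Bool
x <ᵇ y = does (x ℤ.<? y)
x >ᵇ y = y <ᵇ x

<ᵇ-true⁻¹ : ∀ x y → x <ᵇ y ≡ true → x ℤ.< y
<ᵇ-true⁻¹ x y e with yes p ← x ℤ.<? y = p

<ᵇ-total : ∀ {x y} → x ≢ y → y <ᵇ x ≡ not (x <ᵇ y)
<ᵇ-total {x} {y} x≢y with x ℤ.<? y
... | yes x<y = dec-false (y ℤ.<? x) (ℤₚ.<-asym x<y)
... | no  x≮y = dec-true (y ℤ.<? x) (ℤₚ.≤∧≢⇒< (ℤₚ.≮⇒≥ x≮y) (x≢y ∘ ≡.sym))

<ᵇ-trans : ∀ x y z → x <ᵇ y ≡ true → y <ᵇ z ≡ true → x <ᵇ z ≡ true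
<ᵇ-trans x y z p q = dec-true (x ℤ.<? z) (ℤₚ.<-trans (<ᵇ-true⁻¹ x y p) (<ᵇ-true⁻¹ y z q))

-- A descent in front lengthens the decreasing run by one and so flips its parity.
isDes-> : ∀ x y w → x >ᵇ y ≡ true → isDes (x ∷ y ∷ w) ≡ not (isDes (y ∷ w))
isDes-> x y w e rewrite e = even-suc (decRun (y ∷ w))

isDes-≯ : ∀ x y w → x >ᵇ y ≡ false → isDes (x ∷ y ∷ w) ≡ false
isDes-≯ x y w e rewrite e = ≡.refl

nonDesPrefix-∷ : ∀ x w → isDes (x ∷ w) ≡ false → nonDesPrefix (x ∷ w) ≡ x ∷ nonDesPrefix w
nonDesPrefix-∷ x w e rewrite e = ≡.refl

nonDesPrefix-des : ∀ w → isDes w ≡ true → nonDesPrefix w ≡ []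
nonDesPrefix-des []      e = ≡.refl
nonDesPrefix-des (x ∷ w) e rewrite e = ≡.refl

-- A positive letter before w⁻ would start a descent, making the word it begins a desarrangement.
pix⁻-after-positive : ∀ k w → isDes (+ k ∷ w) ≡ false → pix⁻ w ≡ 0
pix⁻-after-positive k []      e = ≡.refl
pix⁻-after-positive k (y ∷ w) e with isDes (y ∷ w) in d
... | true  = ≡.refl
pix⁻-after-positive k (+ l ∷ w) e      | false = ≡.refl
pix⁻-after-positive k (-[1+ l ] ∷ w) e | false
  with () ← ≡.trans (≡.sym e) (≡.trans (isDes-> (+ k) -[1+ l ] w ≡.refl) (≡.cong not d))

-- Weights of signed words and the pix statistics.

module Weights {c ℓ} (R : CommutativeRing c ℓ)
  (inv! : ℕ → RingKit.Carrier R) (inv!-inverse : RingKit.InvertsFactorials R inv!)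
  (y₀ y₁ z : RingKit.Carrier R) where

  open RingKit R
  open Exponential R inv! inv!-inverse
  open Arrangements R inv! inv!-inverse
  open ≈-Reasoning
  open RingProperties ring using (-‿distribˡ-*; -‿+-comm)

  private
    q : Carrier
    q = 1# + z

  negWeight : ℤ → Carrier
  negWeight x = if isNeg x then z else 1#

  negMonomial : List ℤ → Carrier
  negMonomial w = z ^ neg w

  negMonomial-∷ : ∀ x w → negMonomial (x ∷ w) ≈ negWeight x * negMonomial w
  negMonomial-∷ (+ k)    w = sym (*-identityˡ _)
  negMonomial-∷ -[1+ k ] w = refl

  negMonomial-average : Average negMonomial (geo q)
  negMonomial-average zero    A u l = sym (trans (*-congʳ (+-identityʳ _)) (*-identityˡ _))
  negMonomial-average (suc n) A u l = begin
    ∑arr (suc n) A negMonomial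
      ≈⟨ ∑arr-first-const n A negMonomial negWeight negMonomial-∷ (λ a → refl) u l (negMonomial-average n) ⟩
    fromℕ (suc n) * (q * (fromℕ (n !) * q ^ n))
      ≈⟨ solve 4 (λ a b c d → a :* (b :* (c :* d)) := c :* (a :* (b :* d))) refl _ _ _ _ ⟩
    fromℕ (n !) * (fromℕ (suc n) * (q * q ^ n))
      ≈⟨ fromℕ-suc! n _ ⟨
    fromℕ (suc n !) * q ^ suc n ∎

  desMonomial : List ℤ → Carrier
  desMonomial w = if isDes w then negMonomial w else 0#

  desMonomial-des : ∀ w → isDes w ≡ true → desMonomial w ≈ negMonomial w
  desMonomial-des w e = reflexive (≡.cong (λ b → if b then negMonomial w else 0#) e)

  desMonomial-nondes : ∀ w → isDes w ≡ false → desMonomial w ≈ 0#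
  desMonomial-nondes w e = reflexive (≡.cong (λ b → if b then negMonomial w else 0#) e)

  -- The minus sign in the weight of each letter supplies the factor (-1)ᵏ of the
  -- inclusion-exclusion.
  module Decreasing = Chain _>ᵇ_ (λ ne → <ᵇ-total (ne ∘ ≡.sym))
    (λ x y w p q → <ᵇ-trans w y x q p) (λ x → - negWeight x)

  -- Σ_{k ≤ d} (-1)^k is 1 or 0 according to the parity of the length d of the decreasing run.
  desMonomial-chainSum : ∀ w → Decreasing.chainSum negMonomial w ≈ desMonomial w
  desMonomial-chainSum [] = refl
  desMonomial-chainSum (x ∷ w) = begin
    chainSum negMonomial (x ∷ w)
      ≈⟨ chainSum-∷ negMonomial x w ⟩
    negMonomial (x ∷ w) + - negWeight x * chainFromSum x negMonomial w
      ≈⟨ +-cong (negMonomial-∷ x w) (sym (-‿distribˡ-* _ _)) ⟩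
    negWeight x * negMonomial w + - (negWeight x * chainFromSum x negMonomial w)
      ≈⟨ cases w (desMonomial-chainSum w) ⟩
    desMonomial (x ∷ w) ∎
    where
    open Decreasing
    cancel : ∀ w {t} → t ≈ negMonomial w → negWeight x * negMonomial w + - (negWeight x * t) ≈ 0#
    cancel w e = trans (+-congˡ (-‿cong (*-congˡ e))) (-‿inverseʳ _)
    cases : ∀ w → chainSum negMonomial w ≈ desMonomial w →
            negWeight x * negMonomial w + - (negWeight x * chainFromSum x negMonomial w)
            ≈ desMonomial (x ∷ w)
    cases [] _ = cancel [] refl
    -- Without a descent only the cuts of length 0 and 1 survive, and they cancel. At a descent the
    -- subtracted sum is the full one for the tail, so the value 0 or 1 of the indicator is flipped.
    cases (y ∷ w) ih with true⊎false (x >ᵇ y)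
    ... | inj₂ xy = trans (cancel (y ∷ w) (chainFromSum-⋢ x negMonomial y w xy))
                        (sym (desMonomial-nondes (x ∷ y ∷ w) (isDes-≯ x y w xy)))
    ... | inj₁ xy with true⊎false (isDes (y ∷ w))
    ...   | inj₁ d = trans
            (cancel (y ∷ w) (trans (chainFromSum-⊏ x negMonomial y w xy)
                    (trans ih (desMonomial-des (y ∷ w) d))))
            (sym (desMonomial-nondes (x ∷ y ∷ w) (≡.trans (isDes-> x y w xy) (≡.cong not d))))
    ...   | inj₂ d = begin
            negWeight x * negMonomial (y ∷ w) + - (negWeight x * chainFromSum x negMonomial (y ∷ w))
              ≈⟨ +-cong (sym (negMonomial-∷ x (y ∷ w))) (-‿cong (*-congˡ
                   (trans (chainFromSum-⊏ x negMonomial y w xy)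
                   (trans ih (desMonomial-nondes (y ∷ w) d))))) ⟩
            negMonomial (x ∷ y ∷ w) + - (negWeight x * 0#)
              ≈⟨ trans (+-congˡ (trans (-‿distribˡ-* _ _) (zeroʳ _))) (+-identityʳ _) ⟩
            negMonomial (x ∷ y ∷ w)
              ≈⟨ desMonomial-des (x ∷ y ∷ w) (≡.trans (isDes-> x y w xy) (≡.cong not d)) ⟨
            desMonomial (x ∷ y ∷ w) ∎

  desMonomial-average : Average desMonomial (exp (- q) ⊛ geo q)
  desMonomial-average = Average-cong {H = exp (- q) ⊛ geo q} (λ w _ → desMonomial-chainSum w)
    (Decreasing.chainSum-average (λ a → -‿+-comm 1# z) {H = geo q} negMonomial-average)

  pixMonomial : List ℤ → Carrier
  pixMonomial w = y₀ ^ pix⁺ w * (y₁ ^ pix⁻ w * z ^ neg w)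

  pixWeight : ℤ → Carrier
  pixWeight x = if isNeg x then y₁ * z else y₀

  pixMonomial-des : ∀ w → isDes w ≡ true → pixMonomial w ≈ negMonomial w
  pixMonomial-des w e rewrite nonDesPrefix-des w e = trans (*-identityˡ _) (*-identityˡ _)

  -- The first letter belongs to the prefix before the longest desarrangement. A negative one
  -- lengthens w⁻; a positive one makes w⁻ empty, and then `pix⁻ w` vanishes as well, so only `pix⁺`
  -- grows.
  pixMonomial-nondes : ∀ x w → isDes (x ∷ w) ≡ false → pixMonomial (x ∷ w) ≈ pixWeight x * pixMonomial w
  pixMonomial-nondes (+ k) w e
    rewrite nonDesPrefix-∷ (+ k) w e | pix⁻-after-positive k w e = *-assoc _ _ _
  pixMonomial-nondes -[1+ k ] w e
    rewrite nonDesPrefix-∷ -[1+ k ] w e =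
      solve 5 (λ a b c d e → a :* (b :* c :* (d :* e)) := b :* d :* (a :* (c :* e))) refl _ _ _ _ _

  module Increasing = Chain _<ᵇ_ <ᵇ-total <ᵇ-trans pixWeight

  -- Exactly one cut contributes. If the word begins with an ascent it is no desarrangement and the
  -- sum passes to the tail. If it begins with a descent no cut goes beyond the first letter, and by
  -- parity exactly one of the word and its tail is a desarrangement. Distinct letters ensure that
  -- one of the two happens.
  pixMonomial-chainSum : ∀ w → Unique w → Increasing.chainSum desMonomial w ≈ pixMonomial w
  pixMonomial-chainSum []      _ = sym (pixMonomial-des [] ≡.refl)
  pixMonomial-chainSum (x ∷ w) u = trans (chainSum-∷ desMonomial x w) (cases w u (pixMonomial-chainSum w (AllPairs.tail u)))
    where
    open Increasing
    nondes : ∀ {x w t} → isDes (x ∷ w) ≡ false → t ≈ pixMonomial w →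
      desMonomial (x ∷ w) + pixWeight x * t ≈ pixMonomial (x ∷ w)
    nondes {x} {w} d e = trans (+-cong (desMonomial-nondes (x ∷ w) d) (*-congˡ e))
      (trans (+-identityˡ _) (sym (pixMonomial-nondes x w d)))
    flip-des : ∀ {y w b} → x ≢ y → x <ᵇ y ≡ false → isDes (y ∷ w) ≡ b → isDes (x ∷ y ∷ w) ≡ not b
    flip-des {y} {w} x≢y xy d =
      ≡.trans (isDes-> x y w (≡.trans (<ᵇ-total x≢y) (≡.cong not xy))) (≡.cong not d)
    cases : ∀ w → Unique (x ∷ w) → chainSum desMonomial w ≈ pixMonomial w →
      desMonomial (x ∷ w) + pixWeight x * chainFromSum x desMonomial w ≈ pixMonomial (x ∷ w)
    cases [] _ _ = nondes {x} {[]} ≡.refl (sym (pixMonomial-des [] ≡.refl))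
    cases (y ∷ w) ((x≢y ∷ _) ∷ _) ih with true⊎false (x <ᵇ y)
    ... | inj₁ xy = nondes {x} {y ∷ w} (isDes-≯ x y w (≡.trans (<ᵇ-total x≢y) (≡.cong not xy)))
                   (trans (chainFromSum-⊏ x desMonomial y w xy) ih)
    ... | inj₂ xy with true⊎false (isDes (y ∷ w))
    ...   | inj₁ d = nondes {x} {y ∷ w} (flip-des {w = w} x≢y xy d)
                   (trans (chainFromSum-⋢ x desMonomial y w xy)
                     (trans (desMonomial-des (y ∷ w) d) (sym (pixMonomial-des (y ∷ w) d))))
    ...   | inj₂ d = begin
            desMonomial (x ∷ y ∷ w) + pixWeight x * chainFromSum x desMonomial (y ∷ w)
              ≈⟨ +-cong (desMonomial-des (x ∷ y ∷ w) (flip-des {w = w} x≢y xy d)) (*-congˡ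
                   (trans (chainFromSum-⋢ x desMonomial y w xy) (desMonomial-nondes (y ∷ w) d))) ⟩
            negMonomial (x ∷ y ∷ w) + pixWeight x * 0#
              ≈⟨ trans (+-congˡ (zeroʳ _)) (+-identityʳ _) ⟩
            negMonomial (x ∷ y ∷ w)
              ≈⟨ pixMonomial-des (x ∷ y ∷ w) (flip-des {w = w} x≢y xy d) ⟨
            pixMonomial (x ∷ y ∷ w) ∎

  pixMonomial-average : Average pixMonomial (exp (y₀ + y₁ * z) ⊛ (exp (- q) ⊛ geo q))
  pixMonomial-average = Average-cong {H = exp (y₀ + y₁ * z) ⊛ (exp (- q) ⊛ geo q)} pixMonomial-chainSum
    (Increasing.chainSum-average (λ a → refl) {H = exp (- q) ⊛ geo q} desMonomial-average)

  -- Fixed points: sums over arrangements as permanents.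

  rowProduct : List (ℤ → Carrier) → List ℤ → Carrier
  rowProduct []       w       = 1#
  rowProduct (φ ∷ φs) []      = 0#
  rowProduct (φ ∷ φs) (x ∷ w) = φ x * rowProduct φs w

  rowProduct-[] : ∀ φs ψ χs → rowProduct (φs ++ ψ ∷ χs) [] ≈ 0#
  rowProduct-[] []       ψ χs = refl
  rowProduct-[] (φ ∷ φs) ψ χs = refl

  -- Moving a row to the front is undone by moving the first letter back to that row; with
  -- `∑arr-rot` this lets the permanent be expanded along any row.
  rowProduct-rot : ∀ φs ψ χs w →
    rowProduct (φs ++ ψ ∷ χs) (rot (length φs) w) ≈ rowProduct (ψ ∷ φs ++ χs) w
  rowProduct-rot []       ψ χs w           = refl
  rowProduct-rot (φ ∷ φs) ψ χs []          = refl
  rowProduct-rot (φ ∷ φs) ψ χs (x ∷ [])    =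
    trans (*-congˡ (rowProduct-[] φs ψ χs)) (trans (zeroʳ _) (sym (zeroʳ _)))
  rowProduct-rot (φ ∷ φs) ψ χs (x ∷ y ∷ w) = trans (*-congˡ (rowProduct-rot φs ψ χs (x ∷ w)))
    (solve 3 (λ a b c → a :* (b :* c) := b :* (a :* c)) refl _ _ _)

  rowProduct-+ : ∀ φs ψ χ χs {φ} → (∀ x → φ x ≈ ψ x + χ x) → ∀ w →
    rowProduct (φs ++ φ ∷ χs) w ≈ rowProduct (φs ++ ψ ∷ χs) w + rowProduct (φs ++ χ ∷ χs) w
  rowProduct-+ []       ψ χ χs e []      = sym (+-identityˡ _)
  rowProduct-+ []       ψ χ χs e (x ∷ w) = trans (*-congʳ (e x)) (distribʳ _ _ _)
  rowProduct-+ (_ ∷ φs) ψ χ χs e []      = sym (+-identityˡ _)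
  rowProduct-+ (_ ∷ φs) ψ χ χs e (x ∷ w) = trans (*-congˡ (rowProduct-+ φs ψ χ χs e w)) (distribˡ _ _ _)

  pick-none : ∀ A (δ : ℕ → Carrier) X → All (λ b → δ b ≈ 0#) A → pick A (λ b B → δ b * X B) ≈ 0#
  pick-none []      δ X []       = refl
  pick-none (a ∷ A) δ X (e ∷ es) =
    trans (+-cong (trans (*-congʳ e) (zeroˡ _)) (pick-none A δ (λ B → X (a ∷ B)) es)) (+-identityˡ _)

  pick-only : ∀ A a B (δ : ℕ → Carrier) X → Unique (A ++ a ∷ B) → (∀ b → b ≢ a → δ b ≈ 0#) →
    pick (A ++ a ∷ B) (λ b C → δ b * X C) ≈ δ a * X (A ++ B)
  pick-only []      a B δ X (ne ∷ _) z′ = trans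
    (+-congˡ (pick-none B δ (λ C → X (a ∷ C)) (All.map (λ a≢b → z′ _ (a≢b ∘ ≡.sym)) ne)))
    (+-identityʳ _)
  pick-only (x ∷ A) a B δ X (ne ∷ u) z′ = trans
    (+-cong (trans (*-congʳ (z′ x (All.head (Allₚ.++⁻ʳ A ne)))) (zeroˡ _))
            (pick-only A a B δ (λ C → X (x ∷ C)) u z′))
    (+-identityˡ _)

  -- The row of position a + 1: the factor that a letter contributes when placed there, sign weight
  -- included. `excess` is its deviation from `negWeight`.
  fixWeight excess : ℕ → ℤ → Carrier
  fixWeight a x =
    if does (x ℤ.≟ + suc a) then y₀ else if does (x ℤ.≟ -[1+ a ]) then y₁ * z else negWeight x
  excess a x =
    if does (x ℤ.≟ + suc a) then y₀ + - 1# else if does (x ℤ.≟ -[1+ a ]) then y₁ * z + - z else 0#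

  private
    split : ∀ x y → x ≈ y + (x + - y)
    split x y = sym (trans (solve 3 (λ x y m → y :+ (x :+ m) := x :+ (y :+ m)) refl x y (- y))
      (trans (+-congˡ (-‿inverseʳ y)) (+-identityʳ x)))

  fixWeight-excess : ∀ a x → fixWeight a x ≈ negWeight x + excess a x
  fixWeight-excess a x with x ℤ.≟ + suc a
  ... | yes ≡.refl = split y₀ 1#
  ... | no _ with x ℤ.≟ -[1+ a ]
  ...   | yes ≡.refl = split (y₁ * z) z
  ...   | no _       = sym (+-identityʳ _)

  δ : Carrier
  δ = (y₀ + y₁ * z) + - q

  signed-excess : ∀ a → signed a (excess a) ≈ δ
  signed-excess a
    -- The equality test between the two negative letters reduces to the same Boolean, so one
    -- rewrite settles both signs.
    rewrite dec-true (+ suc a ℤ.≟ + suc a) ≡.refl =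
    trans (+-interchange _ _ _ _) (+-congˡ (-‿+-comm 1# z))

  signed-excess-≢ : ∀ a b → b ≢ a → signed b (excess a) ≈ 0#
  signed-excess-≢ a b b≢a
    rewrite dec-false (+ suc b ℤ.≟ + suc a) (λ e → b≢a (ℕₚ.suc-injective (ℤₚ.+-injective e))) =
    +-identityˡ _

  -- The j-th derivative of geo q.
  geoD : ℕ → Series
  geoD j i = inv! i * (fromℕ ((j ℕ.+ i) !) * q ^ (j ℕ.+ i))

  D-geoD : ∀ j → D (geoD j) ≋ geoD (suc j)
  D-geoD j i rewrite ℕₚ.+-suc j i = trans (sym (*-assoc _ _ _)) (*-congʳ (inv!-suc i))

  -- The Leibniz rule for `exp δ ⊛ geoD j`, read at one coefficient; it has the shape of the
  -- recursion that expands one row of the permanent.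
  excess-step : ∀ j m → fromℕ (suc m !) * (exp δ ⊛ geoD j) (suc m)
    ≈ fromℕ (m !) * (exp δ ⊛ geoD (suc j)) m + δ * (fromℕ (m !) * (exp δ ⊛ geoD j) m)
  excess-step j m = begin
    fromℕ (suc m !) * (exp δ ⊛ geoD j) (suc m)
      ≈⟨ fromℕ-suc! m _ ⟩
    fromℕ (m !) * D (exp δ ⊛ geoD j) m
      ≈⟨ *-congˡ (D-⊛ (exp δ) (geoD j) m) ⟩
    fromℕ (m !) * ((D (exp δ) ⊛ geoD j) m + (exp δ ⊛ D (geoD j)) m)
      ≈⟨ *-congˡ (+-cong (trans (⊛-cong {g = geoD j} (D-exp δ) (λ _ → refl) m) (scale-⊛ δ (exp δ) (geoD j) m))
                         (⊛-cong {exp δ} (λ _ → refl) (D-geoD j) m)) ⟩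
    fromℕ (m !) * (δ * (exp δ ⊛ geoD j) m + (exp δ ⊛ geoD (suc j)) m)
      ≈⟨ solve 4 (λ k d a b → k :* (d :* a :+ b) := k :* b :+ d :* (k :* a)) refl _ _ _ _ ⟩
    fromℕ (m !) * (exp δ ⊛ geoD (suc j)) m + δ * (fromℕ (m !) * (exp δ ⊛ geoD j) m) ∎

  replicate-++-∷ : ∀ j (φ : ℤ → Carrier) φs → replicate j φ ++ φ ∷ φs ≡ φ ∷ replicate j φ ++ φs
  replicate-++-∷ zero    φ φs = ≡.refl
  replicate-++-∷ (suc j) φ φs = ≡.cong (φ ∷_) (replicate-++-∷ j φ φs)

  rowProduct-negWeight : ∀ w → rowProduct (replicate (length w) negWeight) w ≈ negMonomial w
  rowProduct-negWeight []      = refl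
  rowProduct-negWeight (x ∷ w) = trans (*-congˡ (rowProduct-negWeight w)) (sym (negMonomial-∷ x w))

  -- By multilinearity in the row of a the permanent splits into the one where a is no longer
  -- marked and the one where ±a is placed in that row and then deleted.
  partialFix : ∀ P j A {n} → length A ≡ j → Unique (A ++ P) → length (A ++ P) ≡ n →
    ∑arr n (A ++ P) (rowProduct (replicate j negWeight ++ map fixWeight P))
      ≈ fromℕ (length P !) * (exp δ ⊛ geoD j) (length P)
  partialFix [] j A ≡.refl u ≡.refl
    rewrite Listₚ.++-identityʳ A | Listₚ.++-identityʳ (replicate (length A) negWeight)
          | ℕₚ.+-identityʳ (length A) = begin
    ∑arr (length A) A (rowProduct (replicate (length A) negWeight))
      ≈⟨ ∑arr-cong (length A) A ≡.refl (λ w p → trans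
           (reflexive (≡.cong (λ k → rowProduct (replicate k negWeight) w) (≡.sym (arrangement-length p))))
           (rowProduct-negWeight w)) ⟩
    ∑arr (length A) A negMonomial
      ≈⟨ negMonomial-average (length A) A u ≡.refl ⟩
    fromℕ (length A !) * q ^ length A
      ≈⟨ solve 1 (λ x → x := (con 1 :+ con 0) :* (con 1 :* (con 1 :* x))) refl _ ⟩
    fromℕ (0 !) * (1# * (1# * (fromℕ (length A !) * q ^ length A)))
      ≈⟨ *-congˡ (*-cong (exp-zero δ) (*-congʳ inv!-zero)) ⟨
    fromℕ (0 !) * (exp δ 0 * (inv! 0 * (fromℕ (length A !) * q ^ length A))) ∎
  partialFix (a ∷ P) j A {zero} l u n≡ with () ← ≡.trans (≡.sym (Listₚ.length-++-sucʳ A a P)) n≡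
  partialFix (a ∷ P) j A {suc n} l u n≡ = begin
    ∑arr (suc n) (A ++ a ∷ P) (rowProduct (stars ++ fixWeight a ∷ marks))
      ≈⟨ ∑arr-cong′ (suc n) (A ++ a ∷ P) (rowProduct-+ stars negWeight (excess a) marks (fixWeight-excess a)) ⟩
    ∑arr (suc n) (A ++ a ∷ P) (λ w → rowProduct (stars ++ negWeight ∷ marks) w + rowProduct (stars ++ excess a ∷ marks) w)
      ≈⟨ ∑arr-+ (suc n) (A ++ a ∷ P) (rowProduct (stars ++ negWeight ∷ marks)) (rowProduct (stars ++ excess a ∷ marks)) ⟩
    ∑arr (suc n) (A ++ a ∷ P) (rowProduct (stars ++ negWeight ∷ marks))
      + ∑arr (suc n) (A ++ a ∷ P) (rowProduct (stars ++ excess a ∷ marks))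
      ≈⟨ +-cong unmark delete ⟩
    fromℕ (length P !) * (exp δ ⊛ geoD (suc j)) (length P) + δ * (fromℕ (length P !) * (exp δ ⊛ geoD j) (length P))
      ≈⟨ excess-step j (length P) ⟨
    fromℕ (suc (length P) !) * (exp δ ⊛ geoD j) (suc (length P)) ∎
    where
    stars marks : List (ℤ → Carrier)
    stars = replicate j negWeight
    marks = map fixWeight P
    unmark : ∑arr (suc n) (A ++ a ∷ P) (rowProduct (stars ++ negWeight ∷ marks))
             ≈ fromℕ (length P !) * (exp δ ⊛ geoD (suc j)) (length P)
    -- The plain row joins the block of `negWeight` rows, so `a` moves to the labels without a
    -- marked row and j grows by one.
    unmark rewrite replicate-++-∷ j negWeight marks | ≡.sym (Listₚ.∷ʳ-++ A a P) =
      partialFix P (suc j) (A ∷ʳ a) (≡.trans (Listₚ.length-++-sucʳ A a []) (≡.cong suc (≡.trans (≡.cong length (Listₚ.++-identityʳ A)) l))) u n≡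
    delete : ∑arr (suc n) (A ++ a ∷ P) (rowProduct (stars ++ excess a ∷ marks))
             ≈ δ * (fromℕ (length P !) * (exp δ ⊛ geoD j) (length P))
    delete = begin
      ∑arr (suc n) (A ++ a ∷ P) (rowProduct (stars ++ excess a ∷ marks))
        ≈⟨ ∑arr-rot (length stars) (suc n) (A ++ a ∷ P) (rowProduct (stars ++ excess a ∷ marks)) ⟩
      ∑arr (suc n) (A ++ a ∷ P) (rowProduct (stars ++ excess a ∷ marks) ∘ rot (length stars))
        ≈⟨ ∑arr-cong′ (suc n) (A ++ a ∷ P) (rowProduct-rot stars (excess a) marks) ⟩
      ∑arr (suc n) (A ++ a ∷ P) (rowProduct (excess a ∷ stars ++ marks))
        ≈⟨ ∑arr-first n (A ++ a ∷ P) (rowProduct (excess a ∷ stars ++ marks)) (excess a) (λ x w → refl) ⟩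
      pick (A ++ a ∷ P) (λ b B → signed b (excess a) * ∑arr n B (rowProduct (stars ++ marks)))
        ≈⟨ pick-only A a P (λ b → signed b (excess a)) (λ B → ∑arr n B (rowProduct (stars ++ marks))) u (signed-excess-≢ a) ⟩
      signed a (excess a) * ∑arr n (A ++ P) (rowProduct (stars ++ marks))
        ≈⟨ *-cong (signed-excess a) (partialFix P j A l (AllPairs.tail (Unique-↭ (↭ₚ.shift a A P) u))
             (ℕₚ.suc-injective (≡.trans (≡.sym (Listₚ.length-++-sucʳ A a P)) n≡))) ⟩
      δ * (fromℕ (length P !) * (exp δ ⊛ geoD j) (length P)) ∎

  fixMonomial : List ℤ → Carrier
  fixMonomial w = y₀ ^ fix⁺ w * (y₁ ^ fix⁻ w * z ^ neg w)

  fixMonomial-rowProduct : ∀ w → fixMonomial w ≈ rowProduct (map fixWeight (upTo (length w))) w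
  -- The positions of the tail are shifted by one; replacing `id` by an arbitrary `f` lets the
  -- induction pass to `f ∘ suc`.
  fixMonomial-rowProduct = go id
    where
    at : (ℕ → ℕ) → List ℤ → List (ℕ × ℤ)
    at f w = zipWith _,_ (map suc (applyUpTo f (length w))) w
    go : ∀ f w →
      y₀ ^ count (λ p → does (proj₂ p ℤ.≟ + proj₁ p)) (at f w)
        * (y₁ ^ count (λ p → does (proj₂ p ℤ.≟ ℤ.- (+ proj₁ p))) (at f w) * z ^ neg w)
      ≈ rowProduct (map fixWeight (applyUpTo f (length w))) w
    go f []      = trans (*-identityˡ _) (*-identityˡ _)
    go f (x ∷ w) with x ℤ.≟ + suc (f 0)
    ... | yes ≡.refl = trans (*-assoc _ _ _) (*-congˡ (go (f ∘ suc) w))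
    ... | no _ with x ℤ.≟ -[1+ f 0 ]
    ...   | yes ≡.refl = trans
            (solve 5 (λ a b c d e → a :* (b :* c :* (d :* e)) := b :* d :* (a :* (c :* e))) refl _ _ _ _ _)
            (*-congˡ (go (f ∘ suc) w))
    ...   | no _ = trans (*-congˡ (*-congˡ (negMonomial-∷ x w))) (trans
            (solve 4 (λ a b c d → a :* (b :* (c :* d)) := c :* (a :* (b :* d))) refl _ _ _ _)
            (*-congˡ (go (f ∘ suc) w)))

  fixMonomial-sum : ∀ n → Unique (upTo n) →
    ∑arr n (upTo n) fixMonomial ≈ fromℕ (n !) * (exp δ ⊛ geo q) n
  fixMonomial-sum n u = begin
    ∑arr n (upTo n) fixMonomial
      ≈⟨ ∑arr-cong n (upTo n) (Listₚ.length-upTo n) (λ w p → trans (fixMonomial-rowProduct w)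
           (reflexive (≡.cong (λ k → rowProduct (map fixWeight (upTo k)) w)
             (≡.trans (arrangement-length p) (Listₚ.length-upTo n))))) ⟩
    ∑arr n (upTo n) (rowProduct (map fixWeight (upTo n)))
      ≈⟨ partialFix (upTo n) 0 [] ≡.refl u (Listₚ.length-upTo n) ⟩
    fromℕ (length (upTo n) !) * (exp δ ⊛ geoD 0) (length (upTo n))
      ≈⟨ reflexive (≡.cong (λ k → fromℕ (k !) * (exp δ ⊛ geoD 0) k) (Listₚ.length-upTo n)) ⟩
    fromℕ (n !) * (exp δ ⊛ geoD 0) n
      ≈⟨ *-congˡ (⊛-cong {exp δ} (λ _ → refl) (λ i → trans (sym (*-assoc _ _ _))
           (trans (*-congʳ (inv!-inverse i)) (*-identityˡ _))) n) ⟩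
    fromℕ (n !) * (exp δ ⊛ geo q) n ∎

-- From filtered words to signed arrangements.

lettersOf : List ℕ → List ℤ
lettersOf A = map (λ i → -[1+ i ]) A ++ map (λ i → + suc i) A

without : ℕ → List ℕ → List ℕ
without a = filter (λ b → ¬? (a ℕ.≟ b))

avoids? : ∀ k → Decidable (All (k ≢_))
avoids? k = All.all? (λ l → ¬? (k ℕ.≟ l))

filter-map-without : ∀ (s : ℕ → ℤ) → (∀ i → ∣ s i ∣ ≡ suc i) → ∀ a A →
  filter (λ x → ¬? (suc a ℕ.≟ ∣ x ∣)) (map s A) ≡ map s (without a A)
filter-map-without s e a []      = ≡.refl
filter-map-without s e a (b ∷ A) rewrite e b with a ℕ.≡ᵇ b
... | true  = filter-map-without s e a A
... | false = ≡.cong (s b ∷_) (filter-map-without s e a A)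

lettersOf-without : ∀ a A → filter (λ x → ¬? (suc a ℕ.≟ ∣ x ∣)) (lettersOf A) ≡ lettersOf (without a A)
lettersOf-without a A = ≡.trans
  (Listₚ.filter-++ (λ x → ¬? (suc a ℕ.≟ ∣ x ∣)) (map (λ i → -[1+ i ]) A) (map (λ i → + suc i) A))
  (≡.cong₂ _++_ (filter-map-without (λ i → -[1+ i ]) (λ _ → ≡.refl) a A)
                (filter-map-without (λ i → + suc i) (λ _ → ≡.refl) a A))

without-head : ∀ a A → without a (a ∷ A) ≡ without a A
without-head a A = Listₚ.filter-reject (λ b → ¬? (a ℕ.≟ b)) (λ ne → ne ≡.refl)

without-all : ∀ a {A} → All (a ≢_) A → without a A ≡ A
without-all a = Listₚ.filter-all (λ b → ¬? (a ℕ.≟ b))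

without-∷ : ∀ {a b} A → a ≢ b → without a (b ∷ A) ≡ b ∷ without a A
without-∷ {a} A = Listₚ.filter-accept (λ b → ¬? (a ℕ.≟ b))

module WordSums {c ℓ} (R : CommutativeRing c ℓ)
  (inv! : ℕ → RingKit.Carrier R) (inv!-inverse : RingKit.InvertsFactorials R inv!) where

  open RingKit R
  open Arrangements R inv! inv!-inverse
  open ≈-Reasoning

  private variable
    A B : Set

  ∑-cong-All : ∀ {P : A → Set} {L : List A} {f g} → All P L → (∀ {x} → P x → f x ≈ g x) → ∑ L f ≈ ∑ L g
  ∑-cong-All []       e = refl
  ∑-cong-All (p ∷ ps) e = +-cong (e p) (∑-cong-All ps e)

  ∑-0 : ∀ (L : List A) → ∑ L (λ _ → 0#) ≈ 0#
  ∑-0 []      = refl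
  ∑-0 (x ∷ L) = trans (+-identityˡ _) (∑-0 L)

  ∑-+ : ∀ (L : List A) f g → ∑ L (λ x → f x + g x) ≈ ∑ L f + ∑ L g
  ∑-+ []      f g = sym (+-identityˡ _)
  ∑-+ (x ∷ L) f g = trans (+-congˡ (∑-+ L f g)) (+-interchange _ _ _ _)

  ∑-++ : ∀ (L M : List A) f → ∑ (L ++ M) f ≈ ∑ L f + ∑ M f
  ∑-++ []      M f = sym (+-identityˡ _)
  ∑-++ (x ∷ L) M f = trans (+-congˡ (∑-++ L M f)) (sym (+-assoc _ _ _))

  ∑-map : ∀ (h : A → B) L f → ∑ (map h L) f ≈ ∑ L (f ∘ h)
  ∑-map h []      f = refl
  ∑-map h (x ∷ L) f = +-congˡ (∑-map h L f)

  ∑-concatMap : ∀ (h : A → List B) L f → ∑ (concatMap h L) f ≈ ∑ L (λ x → ∑ (h x) f)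
  ∑-concatMap h []      f = refl
  ∑-concatMap h (x ∷ L) f = trans (∑-++ (h x) _ f) (+-congˡ (∑-concatMap h L f))

  ∑-filter : ∀ {P : A → Set} (P? : Decidable P) L f →
    ∑ (filter P? L) f ≈ ∑ L (λ x → if does (P? x) then f x else 0#)
  ∑-filter P? []      f = refl
  ∑-filter P? (x ∷ L) f with does (P? x)
  ... | true  = +-congˡ (∑-filter P? L f)
  ... | false = trans (∑-filter P? L f) (sym (+-identityˡ _))

  ∑-words-suc : ∀ m (L : List A) f → ∑ (words (suc m) L) f ≈ ∑ L (λ x → ∑ (words m L) (λ w → f (x ∷ w)))
  ∑-words-suc m L f = trans (∑-concatMap (λ x → map (x ∷_) (words m L)) L f)
    (∑-cong L λ x → ∑-map (x ∷_) (words m L) f)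

  -- Avoidance of an absolute value is tested letter by letter, so it amounts to a smaller alphabet.
  ∑-words-avoiding : ∀ k m L f →
    ∑ (words m L) (λ w → if does (avoids? k (map ∣_∣ w)) then f w else 0#)
      ≈ ∑ (words m (filter (λ x → ¬? (k ℕ.≟ ∣ x ∣)) L)) f
  ∑-words-avoiding k zero    L f = refl
  ∑-words-avoiding k (suc m) L f = begin
    ∑ (words (suc m) L) (λ w → if does (avoids? k (map ∣_∣ w)) then f w else 0#)
      ≈⟨ ∑-words-suc m L _ ⟩
    ∑ L (λ x → ∑ (words m L) (λ w → if does (avoids? k (∣ x ∣ ∷ map ∣_∣ w)) then f (x ∷ w) else 0#))
      ≈⟨ ∑-cong L first ⟩
    ∑ L (λ x → if does (¬? (k ℕ.≟ ∣ x ∣)) then ∑ (words m L′) (λ w → f (x ∷ w)) else 0#)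
      ≈⟨ ∑-filter (λ x → ¬? (k ℕ.≟ ∣ x ∣)) L _ ⟨
    ∑ L′ (λ x → ∑ (words m L′) (λ w → f (x ∷ w)))
      ≈⟨ ∑-words-suc m L′ f ⟨
    ∑ (words (suc m) L′) f ∎
    where
    L′ = filter (λ x → ¬? (k ℕ.≟ ∣ x ∣)) L
    first : ∀ x → ∑ (words m L) (λ w → if does (avoids? k (∣ x ∣ ∷ map ∣_∣ w)) then f (x ∷ w) else 0#)
      ≈ (if does (¬? (k ℕ.≟ ∣ x ∣)) then ∑ (words m L′) (λ w → f (x ∷ w)) else 0#)
    first x with does (k ℕ.≟ ∣ x ∣)
    ... | true  = ∑-0 (words m L)
    ... | false = ∑-words-avoiding k m L (λ w → f (x ∷ w))

  ∑-lettersOf : ∀ A h → ∑ (lettersOf A) h ≈ ∑ A (λ a → signed a h)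
  ∑-lettersOf A h = trans (∑-++ (map (λ i → -[1+ i ]) A) _ h)
    (trans (+-cong (∑-map (λ i → -[1+ i ]) A h) (∑-map (λ i → + suc i) A h))
    (trans (+-comm _ _) (sym (∑-+ A (λ a → h (+ suc a)) (λ a → h -[1+ a ])))))

  -- For distinct labels, deleting by value and deleting by position leave the same list.
  ∑-without : ∀ {A} → Unique A → ∀ h → ∑ A (λ a → h a (without a A)) ≈ pick A h
  ∑-without []               h = refl
  ∑-without {a ∷ A} (ne ∷ u) h = +-cong
    (reflexive (≡.cong (h a) (≡.trans (without-head a A) (without-all a ne))))
    (trans (∑-cong-All ne λ {b} a≢b → reflexive (≡.cong (h b) (without-∷ A (a≢b ∘ ≡.sym))))
           (∑-without u (λ b B → h b (a ∷ B))))

  -- The first letter forbids its absolute value in the rest, so the rest is a word with distinct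
  -- absolute values over the letters of the other labels. Arbitrary `A` in place of `upTo n` makes
  -- the induction possible.
  ∑-uniqueWords : ∀ n {A} → Unique A → ∀ f →
    ∑ (words n (lettersOf A)) (λ w → if does (unique? (map ∣_∣ w)) then f w else 0#) ≈ ∑arr n A f
  ∑-uniqueWords zero        u f = +-identityʳ _
  ∑-uniqueWords (suc n) {A} u f = begin
    ∑ (words (suc n) L) (λ w → if does (unique? (map ∣_∣ w)) then f w else 0#)
      ≈⟨ ∑-words-suc n L _ ⟩
    ∑ L (λ x → ∑ (words n L) (λ w → if does (unique? (∣ x ∣ ∷ map ∣_∣ w)) then f (x ∷ w) else 0#))
      ≈⟨ ∑-lettersOf A _ ⟩
    ∑ A (λ a → signed a λ x → ∑ (words n L) (λ w → if does (unique? (∣ x ∣ ∷ map ∣_∣ w)) then f (x ∷ w) else 0#))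
      ≈⟨ ∑-cong A (λ a → signed-cong a λ x x≡ → rest a x x≡) ⟩
    ∑ A (λ a → signed a λ x → ∑arr n (without a A) (λ w → f (x ∷ w)))
      ≈⟨ ∑-without u (λ a B → signed a λ x → ∑arr n B (λ w → f (x ∷ w))) ⟩
    ∑arr (suc n) A f ∎
    where
    L = lettersOf A
    rest : ∀ a x → ∣ x ∣ ≡ suc a →
      ∑ (words n L) (λ w → if does (unique? (∣ x ∣ ∷ map ∣_∣ w)) then f (x ∷ w) else 0#)
        ≈ ∑arr n (without a A) (λ w → f (x ∷ w))
    rest a x x≡ rewrite x≡ = begin
      ∑ (words n L) (λ w → if does (avoids? (suc a) (map ∣_∣ w)) ∧ does (unique? (map ∣_∣ w)) then f (x ∷ w) else 0#)
        ≈⟨ ∑-cong (words n L) (λ w → reflexive (if-∧ (does (avoids? (suc a) (map ∣_∣ w))))) ⟩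
      ∑ (words n L) (λ w → if does (avoids? (suc a) (map ∣_∣ w)) then g w else 0#)
        ≈⟨ ∑-words-avoiding (suc a) n L g ⟩
      ∑ (words n (filter (λ y → ¬? (suc a ℕ.≟ ∣ y ∣)) L)) g
        ≈⟨ reflexive (≡.cong (λ M → ∑ (words n M) g) (lettersOf-without a A)) ⟩
      ∑ (words n (lettersOf (without a A))) g
        ≈⟨ ∑-uniqueWords n (Uniqueₚ.filter⁺ (λ b → ¬? (a ℕ.≟ b)) u) (λ w → f (x ∷ w)) ⟩
      ∑arr n (without a A) (λ w → f (x ∷ w)) ∎
      where
      g : List ℤ → Carrier
      g w = if does (unique? (map ∣_∣ w)) then f (x ∷ w) else 0#
      if-∧ : ∀ b {b′} {t : Carrier} → (if b ∧ b′ then t else 0#) ≡ (if b then (if b′ then t else 0#) else 0#)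
      if-∧ true  = ≡.refl
      if-∧ false = ≡.refl

  ∑-signedPerms : ∀ n f → ∑ (signedPerms n) f ≈ ∑arr n (upTo n) f
  ∑-signedPerms n f = trans (∑-filter (λ w → unique? (map ∣_∣ w)) (words n (letters n)) f)
    (∑-uniqueWords n (Uniqueₚ.upTo⁺ n) f)

-- Solving the identity for the polynomials.

module Solution {c ℓ} (R : CommutativeRing c ℓ)
  (inv! : ℕ → RingKit.Carrier R) (inv!-inverse : RingKit.InvertsFactorials R inv!)
  (y₀ y₁ z : RingKit.Carrier R) where

  open RingKit R
  open Exponential R inv! inv!-inverse
  open WordSums R inv! inv!-inverse
  open Weights R inv! inv!-inverse y₀ y₁ z

  p q : Carrier
  p = y₀ + y₁ * z
  q = 1# + z

  egfOf : (ℕ → Carrier) → Series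
  egfOf b n = inv! n * b n

  1-uq : Series
  1-uq = S.1# S.+ S.- (X S.* const q)

  const-p : ∀ {f g h} → f S.≈ const y₀ → g S.≈ const y₁ → h S.≈ const z → f S.+ g S.* h S.≈ const p
  const-p e e′ e″ = S.trans (S.+-cong e (S.trans (S.*-cong e′ e″) (S.sym (const-* y₁ z))))
                            (S.sym (const-+ y₀ (y₁ * z)))

  const-q : ∀ {f g} → f S.≈ S.1# → g S.≈ const z → f S.+ g S.≈ const q
  const-q e e′ = S.trans (S.+-cong e e′) (S.sym (const-+ 1# z))

  1-uq-cong : ∀ {f g} → f S.≈ S.1# → g S.≈ X S.* const q → f S.+ S.- g S.≈ 1-uq
  1-uq-cong e e′ = S.+-cong e (S.-‿cong e′)

  -- The generating function identity with both denominators multiplied out.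
  SatisfiesIdentity : (ℕ → Carrier) → Set ℓ
  SatisfiesIdentity b = egfOf b S.* 1-uq S.* exp q S.≈ exp p

  -- Both denominators are invertible series: multiplying by `geo q` and `exp (- q)` isolates the
  -- generating function of `b`.
  solution : ∀ b → SatisfiesIdentity b → ∀ n → b n ≈ fromℕ (n !) * (exp p ⊛ (exp (- q) ⊛ geo q)) n
  solution b hyp n = begin
    b n                                 ≈⟨ *-identityˡ _ ⟨
    1# * b n                            ≈⟨ *-congʳ (inv!-inverse n) ⟨
    inv! n * fromℕ (n !) * b n          ≈⟨ solve 3 (λ i k x → i :* k :* x := k :* (i :* x)) refl _ _ _ ⟩
    fromℕ (n !) * (inv! n * b n)        ≈⟨ *-congˡ (quotient n) ⟩
    fromℕ (n !) * (exp p ⊛ (exp (- q) ⊛ geo q)) n ∎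
    where
    open ≈-Reasoning
    module S′ = S.≈-Reasoning
    F : Series
    F = egfOf b
    exp-inverse : exp q S.* exp (- q) S.≈ S.1#
    exp-inverse = S.trans (exp-+ q (- q)) (S.trans (exp-cong (-‿inverseʳ q)) exp-0)
    quotient : F S.≈ exp p S.* (exp (- q) S.* geo q)
    quotient = S′.begin
      F
        S′.≈⟨ S.trans (S.*-identityʳ _) (S.*-identityʳ _) ⟨
      F S.* S.1# S.* S.1#
        S′.≈⟨ S.*-cong (S.*-congˡ {F} (geo-inverse q)) exp-inverse ⟨
      F S.* (geo q S.* 1-uq) S.* (exp q S.* exp (- q))
        S′.≈⟨ S.solve 5 (λ f g d e e′ → f S.:* (g S.:* d) S.:* (e S.:* e′) S.:= f S.:* d S.:* e S.:* (e′ S.:* g))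
               S.refl F (geo q) 1-uq (exp q) (exp (- q)) ⟩
      F S.* 1-uq S.* exp q S.* (exp (- q) S.* geo q)
        S′.≈⟨ S.*-congʳ {exp (- q) S.* geo q} hyp ⟩
      exp p S.* (exp (- q) S.* geo q) S′.∎

  pix-solution : ∀ b → SatisfiesIdentity b → ∀ n → b n ≈ ∑ (signedPerms n) pixMonomial
  pix-solution b hyp n = trans (solution b hyp n)
    (sym (trans (∑-signedPerms n pixMonomial)
                (pixMonomial-average n (upTo n) (Uniqueₚ.upTo⁺ n) (Listₚ.length-upTo n))))

  fix-solution : ∀ b → SatisfiesIdentity b → ∀ n → b n ≈ ∑ (signedPerms n) fixMonomial
  fix-solution b hyp n = trans (solution b hyp n)
    (sym (trans (∑-signedPerms n fixMonomial) (trans (fixMonomial-sum n (Uniqueₚ.upTo⁺ n))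
      -- `δ` is `p + - q`, so `exp δ` splits into `exp p` and `exp (- q)`.
      (*-congˡ (trans (⊛-cong {g = geo q} (S.sym (exp-+ p (- q))) (λ _ → refl) n)
                      (⊛-assoc (exp p) (exp (- q)) (geo q) n))))))

-- Coefficients of powers of the variable.

module Monomials {c ℓ} (R : CommutativeRing c ℓ) where
  open RingKit R
  open PowerSeries R

  X^-const : ∀ i r n → ((X S.^ i) ⊛ const r) n ≈ (if does (i ℕ.≟ n) then r else 0#)
  X^-const zero    r zero    = 1-⊛ (const r) 0
  X^-const zero    r (suc n) = 1-⊛ (const r) (suc n)
  X^-const (suc i) r zero    = trans (⊛-assoc X (X S.^ i) (const r) 0) (X-⊛-zero ((X S.^ i) ⊛ const r))
  X^-const (suc i) r (suc n) = trans (⊛-assoc X (X S.^ i) (const r) (suc n))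
    (trans (X-⊛-suc ((X S.^ i) ⊛ const r) n) (X^-const i r n))

  X^-coeff : ∀ i n → (X S.^ i) n ≈ (if does (i ℕ.≟ n) then 1# else 0#)
  X^-coeff i n = trans (sym (S.*-identityʳ (X S.^ i) n)) (X^-const i 1# n)

  ^-*-distrib : ∀ f g k → (f S.* g) S.^ k S.≈ (f S.^ k) S.* (g S.^ k)
  ^-*-distrib f g zero    = S.sym (S.*-identityˡ S.1#)
  ^-*-distrib f g (suc k) = S.trans (S.*-congˡ {f S.* g} (^-*-distrib f g k))
    (S.solve 4 (λ a b c d → a S.:* b S.:* (c S.:* d) S.:= a S.:* c S.:* (b S.:* d)) S.refl f g (f S.^ k) (g S.^ k))

  [Xr]^-coeff : ∀ r k n → ((X S.* const r) S.^ k) n ≈ (if does (k ℕ.≟ n) then r ^ k else 0#)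
  [Xr]^-coeff r k n = trans (^-*-distrib X (const r) k n)
    (trans (S.*-congˡ {X S.^ k} (S.sym (const-^ r k)) n) (X^-const k (r ^ k) n))

-- The ring of power series in Y₀, Y₁, Z over the rationals.

ℚ₀ : CommutativeRing 0ℓ 0ℓ
ℚ₀ = ℚₚ.+-*-commutativeRing

module R₀ = RingKit ℚ₀
-- Variables are adjoined from the inside out: Z, then Y₁, then Y₀, and finally u in `P₄`. A nested
-- series is then literally a function of the exponents in the order of `Ser`.
module P₁ = PowerSeries ℚ₀
module P₂ = PowerSeries P₁.series
module P₃ = PowerSeries P₂.series

ℚ[[Y₀,Y₁,Z]] : CommutativeRing 0ℓ 0ℓ
ℚ[[Y₀,Y₁,Z]] = P₃.series

module R₃ = RingKit ℚ[[Y₀,Y₁,Z]]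

fraction-+ : ∀ i j → (i / 1) ℚ.+ (j / 1) ≡ (i ℤ.+ j) / 1
fraction-+ i j = ℚₚ.toℚᵘ-injective (begin
  ℚ.toℚᵘ ((i / 1) ℚ.+ (j / 1))          ≈⟨ ℚₚ.toℚᵘ-homo-+ (i / 1) (j / 1) ⟩
  ℚ.toℚᵘ (i / 1) ℚᵘ.+ ℚ.toℚᵘ (j / 1)    ≈⟨ ℚᵘₚ.+-cong (ℚₚ.toℚᵘ-fromℚᵘ (ℚᵘ.mkℚᵘ i 0)) (ℚₚ.toℚᵘ-fromℚᵘ (ℚᵘ.mkℚᵘ j 0)) ⟩
  ℚᵘ.mkℚᵘ i 0 ℚᵘ.+ ℚᵘ.mkℚᵘ j 0          ≈⟨ ℚᵘ.*≡* (≡.cong (ℤ._* + 1) (≡.cong₂ ℤ._+_ (ℤₚ.*-identityʳ i) (ℤₚ.*-identityʳ j))) ⟩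
  ℚᵘ.mkℚᵘ (i ℤ.+ j) 0                   ≈⟨ ℚₚ.toℚᵘ-fromℚᵘ (ℚᵘ.mkℚᵘ (i ℤ.+ j) 0) ⟨
  ℚ.toℚᵘ ((i ℤ.+ j) / 1)                ∎)
  where open ℚᵘₚ.≃-Reasoning

fraction-inverse : ∀ m .{{_ : ℕ.NonZero m}} → (+ 1 / m) ℚ.* (+ m / 1) ≡ 1ℚ
fraction-inverse m@(suc d) = ℚₚ.toℚᵘ-injective (begin
  ℚ.toℚᵘ ((+ 1 / m) ℚ.* (+ m / 1))          ≈⟨ ℚₚ.toℚᵘ-homo-* (+ 1 / m) (+ m / 1) ⟩
  ℚ.toℚᵘ (+ 1 / m) ℚᵘ.* ℚ.toℚᵘ (+ m / 1)    ≈⟨ ℚᵘₚ.*-cong (ℚₚ.toℚᵘ-fromℚᵘ (ℚᵘ.mkℚᵘ (+ 1) d)) (ℚₚ.toℚᵘ-fromℚᵘ (ℚᵘ.mkℚᵘ (+ m) 0)) ⟩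
  ℚᵘ.mkℚᵘ (+ 1) d ℚᵘ.* ℚᵘ.mkℚᵘ (+ m) 0      ≈⟨ ℚᵘ.*≡* (≡.trans (ℤₚ.*-identityʳ (+ 1 ℤ.* + m)) (≡.cong (λ k → + 1 ℤ.* + suc k) (≡.sym (ℕₚ.*-identityʳ d)))) ⟩
  ℚᵘ.1ℚᵘ                                    ∎)
  where open ℚᵘₚ.≃-Reasoning

fromℕ≡ : ∀ n → R₀.fromℕ n ≡ + n / 1
fromℕ≡ zero    = ≡.refl
fromℕ≡ (suc n) = ≡.trans (≡.cong (1ℚ ℚ.+_) (fromℕ≡ n)) (fraction-+ (+ 1) (+ n))

scalar : ℚ → P₃.Series
scalar r = P₃.const (P₂.const (P₁.const r))

scalar-* : ∀ r f a b c → (scalar r R₃.* f) a b c ≡ r ℚ.* f a b c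
scalar-* r f a b c = ≡.trans (P₃.const-⊛ _ f a b c)
  (≡.trans (P₂.const-⊛ _ (f a) b c) (P₁.const-⊛ r (f a b) c))

inv! : ℕ → P₃.Series
inv! n = scalar (1/! n)

-- Natural numbers of the nested ring are constants, because `const` commutes with `fromℕ`; the
-- claim thereby reduces to the rationals.
inv!-inverse : R₃.InvertsFactorials inv!
inv!-inverse n = R₃.trans
  (R₃.*-congˡ {inv! n} (R₃.sym (R₃.trans
    (P₃.const-cong (P₂.S.trans (P₂.const-cong (P₁.const-fromℕ (n !))) (P₂.const-fromℕ (n !))))
    (P₃.const-fromℕ (n !)))))
  (R₃.trans (R₃.sym (R₃.trans (P₃.const-cong (R₂.trans (P₂.const-cong (P₁.const-* _ _)) (P₂.const-* _ _))) (P₃.const-* _ _)))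
    (P₃.const-cong (P₂.const-cong (P₁.const-cong
      (≡.trans (≡.cong (1/! n ℚ.*_) (fromℕ≡ (n !))) (fraction-inverse (n !) {{n ℕₚ.!≢0}}))))))
  where module R₂ = P₂.S

Y₀ Y₁ Z : P₃.Series
Y₀ = P₃.X
Y₁ = P₃.const P₂.X
Z  = P₃.const (P₂.const P₁.X)

module Sol = Solution ℚ[[Y₀,Y₁,Z]] inv! inv!-inverse Y₀ Y₁ Z
open Sol using (SatisfiesIdentity; egfOf; 1-uq)
module P₄ = Exponential ℚ[[Y₀,Y₁,Z]] inv! inv!-inverse
module S₄ = P₄.S

-- One variable at a time: seen from the outermost variable the other powers are constants, so
-- `X^-const` applies at each level.
monomial-coeff : ∀ i j k a b c → (Y₀ R₃.^ i R₃.* (Y₁ R₃.^ j R₃.* Z R₃.^ k)) a b c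
  ≡ (if does (i ℕ.≟ a) ∧ does (j ℕ.≟ b) ∧ does (k ℕ.≟ c) then 1ℚ else 0ℚ)
monomial-coeff i j k a b c = ≡.trans
  (R₃.*-congˡ {Y₀ R₃.^ i} (R₃.trans
    (R₃.*-cong (R₃.sym (P₃.const-^ P₂.X j))
      (R₃.sym (R₃.trans (P₃.const-cong (P₂.const-^ P₁.X k)) (P₃.const-^ (P₂.const P₁.X) k))))
    (R₃.sym (P₃.const-* (P₂.X P₂.S.^ j) (P₂.const (P₁.X P₁.S.^ k))))) a b c)
  (≡.trans (Monomials.X^-const P₂.series i _ a b c) (at₁ (does (i ℕ.≟ a))))
  where
  at₂ : ∀ d → (if d then P₁.X P₁.S.^ k else P₁.S.0#) c ≡ (if d ∧ does (k ℕ.≟ c) then 1ℚ else 0ℚ)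
  at₂ true  = Monomials.X^-coeff ℚ₀ k c
  at₂ false = ≡.refl
  at₁ : ∀ d → (if d then (P₂.X P₂.S.^ j) P₂.⊛ P₂.const (P₁.X P₁.S.^ k) else P₂.S.0#) b c
    ≡ (if d ∧ does (j ℕ.≟ b) ∧ does (k ℕ.≟ c) then 1ℚ else 0ℚ)
  at₁ true  = ≡.trans (Monomials.X^-const P₁.series j _ b c) (at₂ (does (j ℕ.≟ b)))
  at₁ false = ≡.refl

∑-monomials : (u v : List ℤ → ℕ) (L : List (List ℤ)) → ∀ a b c →
  R₃.∑ L (λ w → Y₀ R₃.^ u w R₃.* (Y₁ R₃.^ v w R₃.* Z R₃.^ neg w)) a b c
  ≡ + count (λ w → does (u w ℕ.≟ a) ∧ does (v w ℕ.≟ b) ∧ does (neg w ℕ.≟ c)) L / 1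
∑-monomials u v L a b c = begin
  R₃.∑ L M a b c                                   ≡⟨ ≡.cong (λ f → f b c) (P₃.∑-coeff L M a) ⟩
  P₂.S.∑ L (λ w → M w a) b c                       ≡⟨ ≡.cong (λ f → f c) (P₂.∑-coeff L (λ w → M w a) b) ⟩
  P₁.S.∑ L (λ w → M w a b) c                       ≡⟨ P₁.∑-coeff L (λ w → M w a b) c ⟩
  R₀.∑ L (λ w → M w a b c)                         ≡⟨ R₀.∑-cong L (λ w → monomial-coeff (u w) (v w) (neg w) a b c) ⟩
  R₀.∑ L (λ w → if p w then 1ℚ else 0ℚ)            ≡⟨ R₀.∑-indicator p L ⟩
  R₀.fromℕ (count p L)                             ≡⟨ fromℕ≡ (count p L) ⟩
  + count p L / 1                                  ∎
  where
  open ≡.≡-Reasoning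
  M : List ℤ → P₃.Series
  M w = Y₀ R₃.^ u w R₃.* (Y₁ R₃.^ v w R₃.* Z R₃.^ neg w)
  p : List ℤ → Bool
  p w = does (u w ℕ.≟ a) ∧ does (v w ℕ.≟ b) ∧ does (neg w ℕ.≟ c)

-- Comparison of the four-variable operations with nested power series.

sumTo-∑≤ : ∀ n {f g} → (∀ i → f i ≡ g i) → sumTo n f ≡ R₀.∑≤ n g
sumTo-∑≤ zero    e = e 0
sumTo-∑≤ (suc n) e = ≡.cong₂ ℚ._+_ (sumTo-∑≤ n e) (e (suc n))

conv₁ : ∀ f g n → (f P₁.⊛ g) n ≡ sumTo n (λ i → f i ℚ.* g (n ∸ i))
conv₁ f g n = ≡.trans (P₁.conv-∑ f g n) (≡.sym (sumTo-∑≤ n λ _ → ≡.refl))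

conv₂ : ∀ f g n m → (f P₂.⊛ g) n m ≡ sumTo n (λ i → sumTo m (λ j → f i j ℚ.* g (n ∸ i) (m ∸ j)))
conv₂ f g n m = ≡.trans (P₂.conv-∑ f g n m) (
  ≡.trans (P₁.∑≤-coeff n _ m) (≡.sym (sumTo-∑≤ n λ i → ≡.sym (conv₁ (f i) (g (n ∸ i)) m))))

conv₃ : ∀ f g n m k → (f P₃.⊛ g) n m k
  ≡ sumTo n (λ i → sumTo m (λ j → sumTo k (λ l → f i j l ℚ.* g (n ∸ i) (m ∸ j) (k ∸ l))))
conv₃ f g n m k = ≡.trans (P₃.conv-∑ f g n m k)
  (≡.trans (≡.cong-app (P₂.∑≤-coeff n _ m) k)
  (≡.trans (P₁.∑≤-coeff n _ k) (≡.sym (sumTo-∑≤ n λ i → ≡.sym (conv₂ (f i) (g (n ∸ i)) m k)))))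

⊗-⊛ : ∀ f g → (f ⊗ g) S₄.≈ (f S₄.* g)
⊗-⊛ f g n a b c = ≡.sym (≡.trans (P₄.conv-∑ f g n a b c)
  (≡.trans (≡.cong-app (≡.cong-app (P₃.∑≤-coeff n _ a) b) c)
  (≡.trans (≡.cong-app (P₂.∑≤-coeff n _ b) c)
  (≡.trans (P₁.∑≤-coeff n _ c) (≡.sym (sumTo-∑≤ n λ i → ≡.sym (conv₃ (f i) (g (n ∸ i)) a b c)))))))

⊗-cong : ∀ {f f′ g g′} → f S₄.≈ f′ → g S₄.≈ g′ → (f ⊗ g) S₄.≈ (f′ S₄.* g′)
⊗-cong {f} {g = g} p q = S₄.trans (⊗-⊛ f g) (S₄.*-cong p q)

⊕-+ : ∀ f g → (f ⊕ g) S₄.≈ (f S₄.+ g)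
⊕-+ f g n a b c = ≡.refl

⊖-+- : ∀ f g → (f ⊖ g) S₄.≈ (f S₄.+ S₄.- g)
⊖-+- f g n a b c = ≡.refl

oneS-1# : oneS S₄.≈ S₄.1#
oneS-1# zero    zero    zero    zero    = ≡.refl
oneS-1# zero    zero    zero    (suc c) = ≡.refl
oneS-1# zero    zero    (suc b) c       = ≡.refl
oneS-1# zero    (suc a) b       c       = ≡.refl
oneS-1# (suc n) a       b       c       = ≡.refl

uS-X : uS S₄.≈ P₄.X
uS-X zero          a       b       c       = ≡.refl
uS-X (suc zero)    zero    zero    zero    = ≡.refl
uS-X (suc zero)    zero    zero    (suc c) = ≡.refl
uS-X (suc zero)    zero    (suc b) c       = ≡.refl
uS-X (suc zero)    (suc a) b       c       = ≡.refl
uS-X (suc (suc n)) a       b       c       = ≡.refl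

Y0S-Y₀ : Y0S S₄.≈ P₄.const Y₀
Y0S-Y₀ zero    zero          b       c       = ≡.refl
Y0S-Y₀ zero    (suc zero)    zero    zero    = ≡.refl
Y0S-Y₀ zero    (suc zero)    zero    (suc c) = ≡.refl
Y0S-Y₀ zero    (suc zero)    (suc b) c       = ≡.refl
Y0S-Y₀ zero    (suc (suc a)) b       c       = ≡.refl
Y0S-Y₀ (suc n) a             b       c       = ≡.refl

Y1S-Y₁ : Y1S S₄.≈ P₄.const Y₁
Y1S-Y₁ zero    zero    zero          c       = ≡.refl
Y1S-Y₁ zero    zero    (suc zero)    zero    = ≡.refl
Y1S-Y₁ zero    zero    (suc zero)    (suc c) = ≡.refl
Y1S-Y₁ zero    zero    (suc (suc b)) c       = ≡.refl
Y1S-Y₁ zero    (suc a) b             c       = ≡.refl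
Y1S-Y₁ (suc n) a       b             c       = ≡.refl

ZS-Z : ZS S₄.≈ P₄.const Z
ZS-Z zero    zero    zero    zero          = ≡.refl
ZS-Z zero    zero    zero    (suc zero)    = ≡.refl
ZS-Z zero    zero    zero    (suc (suc c)) = ≡.refl
ZS-Z zero    zero    (suc b) c             = ≡.refl
ZS-Z zero    (suc a) b       c             = ≡.refl
ZS-Z (suc n) a       b       c             = ≡.refl

^S-^ : ∀ {f g} → f S₄.≈ g → ∀ k → (f ^S k) S₄.≈ (g S₄.^ k)
^S-^ e zero    = oneS-1#
^S-^ e (suc k) = ⊗-cong e (^S-^ e k)

sumTo-last : ∀ n (f : ℕ → ℚ) → (∀ k → k ℕ.< n → f k ≡ 0ℚ) → sumTo n f ≡ f n
sumTo-last zero    f e = ≡.refl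
sumTo-last (suc n) f e = ≡.trans
  (≡.cong (ℚ._+ f (suc n)) (≡.trans (sumTo-last n f (λ k k<n → e k (ℕₚ.m<n⇒m<1+n k<n))) (e n ℕₚ.≤-refl)))
  (ℚₚ.+-identityˡ _)

-- The k-th power of ur is concentrated in u-degree k, so at uⁿ only the last summand k = n of the
-- truncated exponential survives.
expS-exp : ∀ {f} r → f S₄.≈ (P₄.X S₄.* P₄.const r) → expS f S₄.≈ P₄.exp r
expS-exp {f} r e n a b c = ≡.trans
  (sumTo-last n _ λ k k<n → ≡.trans (≡.cong (1/! k ℚ.*_) (≡.trans (power k)
    (≡.cong (λ d → (if d then r R₃.^ k else R₃.0#) a b c) (dec-false (k ℕ.≟ n) (ℕₚ.<⇒≢ k<n)))))
    (ℚₚ.*-zeroʳ (1/! k)))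
  (≡.trans (≡.cong (1/! n ℚ.*_) (≡.trans (power n)
    (≡.cong (λ d → (if d then r R₃.^ n else R₃.0#) a b c) (dec-true (n ℕ.≟ n) ≡.refl))))
    (≡.sym (scalar-* (1/! n) (r R₃.^ n) a b c)))
  where
  power : ∀ k → (f ^S k) n a b c ≡ (if does (k ℕ.≟ n) then r R₃.^ k else R₃.0#) a b c
  power k = ≡.trans (^S-^ e k n a b c) (Monomials.[Xr]^-coeff ℚ[[Y₀,Y₁,Z]] r k n a b c)

egf-inv! : ∀ B → egf B S₄.≈ (λ n → inv! n R₃.* B n)
egf-inv! B n a b c = ≡.trans (ℚₚ.*-comm (B n a b c) (1/! n)) (≡.sym (scalar-* (1/! n) (B n) a b c))

-- Transfer of the hypothesis to nested series, and the conclusion.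

identity : ∀ B →
  (∀ n a b c → (egf B ⊗ (oneS ⊖ uS ⊗ (oneS ⊕ ZS)) ⊗ expS (uS ⊗ (oneS ⊕ ZS))) n a b c
               ≡ expS (uS ⊗ (Y0S ⊕ Y1S ⊗ ZS)) n a b c) →
  SatisfiesIdentity B
identity B hyp n a b c =
  ≡.trans (≡.sym (lhs n a b c)) (≡.trans (hyp n a b c) (expS-exp {uS ⊗ pS} p up n a b c))
  where
  open Sol using (p; q)
  pS qS : Ser
  pS = Y0S ⊕ Y1S ⊗ ZS
  qS = oneS ⊕ ZS
  q-eq : qS S₄.≈ P₄.const q
  q-eq = S₄.trans {qS} {oneS S₄.+ ZS} (⊕-+ oneS ZS) (Sol.const-q {oneS} {ZS} oneS-1# ZS-Z)
  uq : (uS ⊗ qS) S₄.≈ (P₄.X S₄.* P₄.const q)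
  uq = ⊗-cong {uS} {P₄.X} {qS} {P₄.const q} uS-X q-eq
  p-eq : pS S₄.≈ P₄.const p
  p-eq = S₄.trans {pS} {Y0S S₄.+ Y1S ⊗ ZS} (⊕-+ Y0S (Y1S ⊗ ZS))
    (S₄.trans {Y0S S₄.+ Y1S ⊗ ZS} {Y0S S₄.+ Y1S S₄.* ZS}
      (S₄.+-congˡ {Y0S} {Y1S ⊗ ZS} {Y1S S₄.* ZS} (⊗-⊛ Y1S ZS))
      (Sol.const-p {Y0S} {Y1S} {ZS} Y0S-Y₀ Y1S-Y₁ ZS-Z))
  up : (uS ⊗ pS) S₄.≈ (P₄.X S₄.* P₄.const p)
  up = ⊗-cong {uS} {P₄.X} {pS} {P₄.const p} uS-X p-eq
  1-uq-eq : (oneS ⊖ uS ⊗ qS) S₄.≈ 1-uq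
  1-uq-eq = S₄.trans {oneS ⊖ uS ⊗ qS} {oneS S₄.+ S₄.- (uS ⊗ qS)}
    (⊖-+- oneS (uS ⊗ qS)) (Sol.1-uq-cong {oneS} {uS ⊗ qS} oneS-1# uq)
  lhs : (egf B ⊗ (oneS ⊖ uS ⊗ qS) ⊗ expS (uS ⊗ qS)) S₄.≈ (egfOf B S₄.* 1-uq S₄.* P₄.exp q)
  lhs = ⊗-cong {egf B ⊗ (oneS ⊖ uS ⊗ qS)} {egfOf B S₄.* 1-uq} {expS (uS ⊗ qS)} {P₄.exp q}
    (⊗-cong {egf B} {egfOf B} {oneS ⊖ uS ⊗ qS} {1-uq} (egf-inv! B) 1-uq-eq)
    (expS-exp {uS ⊗ qS} q uq)

theorem1p1 : (B : ℕ → ℕ → ℕ → ℕ → ℚ) →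
    (∀ n a b c → (egf B ⊗ (oneS ⊖ uS ⊗ (oneS ⊕ ZS)) ⊗ expS (uS ⊗ (oneS ⊕ ZS))) n a b c
    ≡ expS (uS ⊗ (Y0S ⊕ Y1S ⊗ ZS)) n a b c) →
    ∀ n a b c → (B n a b c ≡ fixPoly n a b c) × (B n a b c ≡ pixPoly n a b c)
theorem1p1 B hyp n a b c =
    ≡.trans (Sol.fix-solution B (identity B hyp) n a b c) (∑-monomials fix⁺ fix⁻ (signedPerms n) a b c)
  , ≡.trans (Sol.pix-solution B (identity B hyp) n a b c) (∑-monomials pix⁺ pix⁻ (signedPerms n) a b c)
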